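{- Let $T$ be a tree with $n\geq 3$ vertices. Then $u(T)\geq\left\lfloor\dfrac{n+3}{5}\right\rfloor$.
   Context: The Toucher-Isolator game on a finite graph $G$ is played by two players, Toucher and Isolator, who alternately claim a previously unclaimed edge of $G$, with Toucher moving first, until all edges have been claimed. A vertex is touched if it is incident to at least one edge claimed by Toucher, and untouched if all edges incident to it are claimed by Isolator. The score of the game is the number of untouched vertices once all edges have been claimed. Toucher aims to minimize the score and Isolator aims to maximize it. $u(G)$ denotes the score of the game on $G$ when both players play optimally. -}

module Defs where

open import Data.Nat using (ℕ; zero; suc; _≤_; _⊓_; _⊔_)
open import Data.Fin using (Fin; _<_; _≟_)
open import Data.Product using (_×_; _,_; Σ; proj₁; proj₂)
open import Data.Sum using (_⊎_)
open import Data.List using (List; []; _∷_; _++_; length; filter; allFin)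
import Data.List.NonEmpty as L⁺
open L⁺ using (List⁺; _∷⁺_; foldr₁)
open import Data.Vec using (Vec; []; _∷_; fromList)
open import Data.List.Membership.Propositional using (_∈_)
open import Data.List.Relation.Unary.All using (All)
open import Data.List.Relation.Unary.Any using (any?)
open import Data.List.Relation.Unary.Linked using (Linked)
open import Data.List.Relation.Unary.Unique.Propositional using (Unique)
open import Relation.Binary.Construct.Closure.ReflexiveTransitive using (Star)
open import Relation.Nullary using (¬_; ¬?; Dec)
open import Relation.Binary.PropositionalEquality using (_≡_)
open import Relation.Nullary.Decidable using (_⊎-dec_)

-- An edge of a simple graph on vertex set Fin n, stored as an ordered pair (a , b) with a < b.
Edge : ℕ → Set
Edge n = Fin n × Fin n

Adj : ∀ {n} → List (Edge n) → Fin n → Fin n → Set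
Adj E u v = ((u , v) ∈ E) ⊎ ((v , u) ∈ E)

IsSimple : ∀ {n} → List (Edge n) → Set
IsSimple E = All (λ e → proj₁ e < proj₂ e) E × Unique E

Connected : ∀ {n} → List (Edge n) → Set
Connected {n} E = (u v : Fin n) → Star (Adj E) u v

Cycle : ∀ {n} → List (Edge n) → Set
Cycle {n} E = Σ (Fin n) λ v → Σ (List (Fin n)) λ ws →
  (2 ≤ length ws) × Unique (v ∷ ws) × Linked (Adj E) (v ∷ ws ++ v ∷ [])

Acyclic : ∀ {n} → List (Edge n) → Set
Acyclic E = ¬ Cycle E

IsTree : ∀ {n} → List (Edge n) → Set
IsTree E = IsSimple E × Connected E × Acyclic E

data Player : Set where
  toucher isolator : Player

other : Player → Player
other toucher = isolator
other isolator = toucher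

picks : ∀ {A : Set} {k} → Vec A (suc k) → List⁺ (A × Vec A k)
picks (x ∷ []) = (x , []) L⁺.∷ []
picks (x ∷ y ∷ ys) = (x , y ∷ ys) ∷⁺ L⁺.map (λ p → proj₁ p , x ∷ proj₂ p) (picks (y ∷ ys))

Incident : ∀ {n} → Fin n → Edge n → Set
Incident v e = (v ≡ proj₁ e) ⊎ (v ≡ proj₂ e)

incident? : ∀ {n} (v : Fin n) (e : Edge n) → Dec (Incident v e)
incident? v e = (v ≟ proj₁ e) ⊎-dec (v ≟ proj₂ e)

-- Final score: number of vertices incident to no edge claimed by Toucher
-- (at the end every edge is claimed, so these are exactly the vertices all of
-- whose incident edges were claimed by Isolator).
score : ∀ {n} → List (Edge n) → ℕ
score {n} T = length (filter (λ v → ¬? (any? (incident? v) T)) (allFin n))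

best : Player → List⁺ ℕ → ℕ
best toucher = foldr₁ _⊓_
best isolator = foldr₁ _⊔_

claim : ∀ {n} → Player → Edge n → List (Edge n) → List (Edge n)
claim toucher e T = e ∷ T
claim isolator e T = T

-- value k p R T : optimal score when the k edges R are still unclaimed,
-- T is the list of edges claimed by Toucher so far, and p is to move.
value : ∀ {n} k → Player → Vec (Edge n) k → List (Edge n) → ℕ
value zero p R T = score T
value (suc k) p R T =
  best p (L⁺.map (λ q → value k (other p) (proj₂ q) (claim p (proj₁ q) T)) (picks R))

u : ∀ {n} → List (Edge n) → ℕ
u E = value (length E) toucher (fromList E) []

{-# OPTIONS --safe #-}
-- Call a vertex marked once Toucher has touched it; let k be the number of unclaimed edges. The potential
--   pot = Σ_{v unmarked} (4 + [v has no unclaimed edge]) + Σ_{e unclaimed} (0, 1 or 3 for 0, 1 or 2 marked ends)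
-- equals 5 · score at the end, and Isolator, when to move, can secure pot ≤ 5 · score + 3 k as long as every
-- component with an edge contains a marked vertex. It suffices that pot drops by at most 6 in two moves.
-- A claim of Toucher costs at most 6, except for a cost of 7 when it joins an unmarked leaf to a vertex
-- all of whose (exactly two) edges have unmarked ends. Isolator therefore
--  * isolates a leaf with an unmarked neighbour (pot grows by 1), else any unmarked leaf (pot does not drop);
--  * without unmarked leaves, looks for an unmarked vertex a of degree 2 with unmarked neighbours b and w such
--    that w has a marked neighbour or degree at least 3, and claims ab; if Toucher answers at a cost of 7, she
--    does so at b, and then isolating a regains 1 while leaving no move of cost 7;
--  * otherwise claims any edge with unmarked ends, which creates no move of cost 7;
--  * if there is no such edge either, the vertices already isolated suffice.
-- On a tree the first move of Toucher costs at most 7, so that 4 n ≤ 5 u + 3 (n - 1) + 4, i.e. n ≤ 5 u + 1.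
module Submission where

open import Defs
open import Data.Bool using (Bool; true; false; _∨_; _∧_; not; if_then_else_)
open import Data.Bool.Properties using (∨-zeroʳ; ¬-not) renaming (_≟_ to _≟ᵇ_)
open import Data.Empty using (⊥-elim)
open import Data.Fin using (Fin; zero; suc; _≟_)
import Data.Fin as Fin
import Data.Fin.Properties as Fin
open import Data.List using (List; []; _∷_; _++_; length; lookup; map; filter; tabulate)
open import Data.List.Membership.Propositional using (_∈_; find; lose)
open import Data.List.Membership.Propositional.Properties using (∈-map⁺; ∈-map⁻; ∈-∃++; ∈-lookup)
import Data.List.NonEmpty as L⁺
open L⁺ using (List⁺; foldr₁)
open import Data.List.Relation.Binary.Permutation.Propositional using (_↭_; ↭-refl; ↭-sym; ↭-trans; prep; swap; ↭⇒↭ₛ)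
open import Data.List.Relation.Binary.Permutation.Propositional.Properties using (map⁺; ∈-resp-↭; All-resp-↭; ↭-length; shift)
import Data.List.Relation.Binary.Permutation.Setoid.Properties as PermSetoid
open import Data.List.Relation.Unary.All as All using (All; []; _∷_)
open import Data.List.Relation.Unary.AllPairs using ([]; _∷_)
open import Data.List.Relation.Unary.Any using (here; there; any?)
open import Data.List.Relation.Unary.Linked as Linked using (Linked; [-]; _∷_)
open import Data.List.Relation.Unary.Unique.Propositional using (Unique)
open import Data.Nat using (ℕ; zero; suc; _≤_; _<_; _+_; _*_; _/_; _⊓_; _⊔_; z≤n; s≤s; _≤?_)
import Data.Nat as ℕ
open import Data.Nat.DivMod using (m<n*o⇒m/o<n)
open import Data.Nat.Induction using (<-rec)
open import Data.Nat.ListAction using (sum)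
open import Data.Nat.ListAction.Properties using (sum-↭)
open import Data.Nat.Properties hiding (_≟_)
open import Data.Nat.Tactic.RingSolver using (solve-∀)
open import Data.Product using (_×_; _,_; ∃-syntax; proj₁; proj₂)
open import Data.Sum as Sum using (_⊎_; inj₁; inj₂)
open import Data.Unit using (⊤; tt)
open import Data.Vec using (Vec; []; _∷_; toList; fromList)
open import Data.Vec.Properties using (toList∘fromList; length-toList)
open import Function using (_∘_)
open import Relation.Binary.Construct.Closure.ReflexiveTransitive using (Star; ε; _◅_)
open import Relation.Binary.PropositionalEquality using (_≡_; _≢_; refl; sym; trans; cong; cong₂; subst; setoid)
open import Relation.Nullary using (¬_; ¬?; Dec; yes; no; does; contradiction)
open import Relation.Nullary.Decidable using (dec-true; dec-false; _×-dec_; _⊎-dec_)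
open import Relation.Unary using (Decidable)
open import Algebra.Properties.CommutativeMonoid.Sum +-0-commutativeMonoid using (∑-distrib-+; sum-cong-≗; sum-replicate-zero) renaming (sum to ∑)

private variable
  n k : ℕ

-- The value of a position

∈⇒≤⊔ : ∀ (xs : List⁺ ℕ) {y} → y ∈ L⁺.toList xs → y ≤ foldr₁ _⊔_ xs
∈⇒≤⊔ (x L⁺.∷ [])     (here refl) = ≤-refl
∈⇒≤⊔ (x L⁺.∷ z ∷ zs) (here refl) = m≤m⊔n x _
∈⇒≤⊔ (x L⁺.∷ z ∷ zs) (there y∈)  = ≤-trans (∈⇒≤⊔ (z L⁺.∷ zs) y∈) (m≤n⊔m x _)

⊓∈ : ∀ x (xs : List ℕ) → foldr₁ _⊓_ (x L⁺.∷ xs) ∈ x ∷ xs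
⊓∈ x [] = here refl
⊓∈ x (z ∷ zs) with ⊓-sel x (foldr₁ _⊓_ (z L⁺.∷ zs))
... | inj₁ eq = here eq
... | inj₂ eq = there (subst (_∈ z ∷ zs) (sym eq) (⊓∈ z zs))

picks-↭ : ∀ {A : Set} {k} (R : Vec A (suc k)) {x R′} →
          (x , R′) ∈ L⁺.toList (picks R) → toList R ↭ x ∷ toList R′
picks-↭ (x ∷ []) (here refl) = ↭-refl
picks-↭ (x ∷ y ∷ ys) (here refl) = ↭-refl
picks-↭ (x ∷ y ∷ ys) (there p∈) with ∈-map⁻ _ p∈
... | (z , S) , q∈ , refl =
  ↭-trans (prep x (picks-↭ (y ∷ ys) q∈)) (swap x z ↭-refl)

∈⇒picks : ∀ {A : Set} {k} (R : Vec A (suc k)) {x} → x ∈ toList R →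
          ∃[ R′ ] (x , R′) ∈ L⁺.toList (picks R)
∈⇒picks (x ∷ []) (here refl) = [] , here refl
∈⇒picks (x ∷ y ∷ ys) (here refl) = y ∷ ys , here refl
∈⇒picks (x ∷ y ∷ ys) (there z∈) with ∈⇒picks (y ∷ ys) z∈
... | R′ , q∈ = x ∷ R′ , there (∈-map⁺ _ q∈)

-- A maximum dominates each of its members, so any edge of Isolator's choice gives a lower bound for
-- the value. The remaining vector is described only up to permutation, which is enough because the
-- potential is a sum.
isolator-move : ∀ {n k} (R : Vec (Edge n) (suc k)) T {e} → e ∈ toList R →
  ∃[ R′ ] toList R ↭ e ∷ toList R′ × value k toucher R′ T ≤ value (suc k) isolator R T
isolator-move R T e∈ with ∈⇒picks R e∈
... | R′ , q∈ = R′ , picks-↭ R q∈ , ∈⇒≤⊔ _ (∈-map⁺ _ q∈)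

-- A minimum is attained, so Toucher's best reply is one concrete edge.
toucher-move : ∀ {n k} (R : Vec (Edge n) (suc k)) T →
  ∃[ e ] ∃[ R′ ] toList R ↭ e ∷ toList R′ × value k isolator R′ (e ∷ T) ≤ value (suc k) toucher R T
toucher-move {k = k} R T with ∈-map⁻ (λ q → value k isolator (proj₂ q) (proj₁ q ∷ T)) (⊓∈ _ _)
... | (e , R′) , q∈ , eq = e , R′ , picks-↭ R q∈ , ≤-reflexive (sym eq)

-- Finite sums

∑-mono : {f g : Fin n → ℕ} → (∀ i → f i ≤ g i) → ∑ f ≤ ∑ g
∑-mono {zero} f≤g = z≤n
∑-mono {suc n} f≤g = +-mono-≤ (f≤g zero) (∑-mono (f≤g ∘ suc))

∑-*ˡ : ∀ m (f : Fin n → ℕ) → ∑ (λ i → m * f i) ≡ m * ∑ f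
∑-*ˡ {zero} m f = sym (*-zeroʳ m)
∑-*ˡ {suc n} m f = trans (cong (m * f zero +_) (∑-*ˡ m (f ∘ suc))) (sym (*-distribˡ-+ m (f zero) _))

∑-const : ∀ n m → ∑ {n} (λ _ → m) ≡ n * m
∑-const zero m = refl
∑-const (suc n) m = cong (m +_) (∑-const n m)

𝟙 : Bool → ℕ
𝟙 true = 1
𝟙 false = 0

δ : Fin n → Fin n → ℕ
δ u v = 𝟙 (does (v ≟ u))

∑-δ : (u : Fin n) → ∑ (δ u) ≡ 1
∑-δ {suc n} zero = cong suc (sum-replicate-zero n)
∑-δ {suc n} (suc u) = ∑-δ u

-- Lifts a pointwise comparison with a surplus at one exceptional vertex to a comparison of sums.
∑-+δ : ∀ (f : Fin n → ℕ) m u → ∑ (λ v → f v + m * δ u v) ≡ ∑ f + m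
∑-+δ f m u = trans (∑-distrib-+ f (λ v → m * δ u v))
  (cong (∑ f +_) (trans (∑-*ˡ m (δ u)) (trans (cong (m *_) (∑-δ u)) (*-identityʳ m))))

length-filter-tabulate : ∀ {A : Set} {P : A → Set} (P? : Decidable P) (g : Fin n → A) →
  length (filter P? (tabulate g)) ≡ ∑ (λ i → 𝟙 (does (P? (g i))))
length-filter-tabulate {zero} P? g = refl
length-filter-tabulate {suc n} P? g with does (P? (g zero))
... | true = cong suc (length-filter-tabulate P? (g ∘ suc))
... | false = length-filter-tabulate P? (g ∘ suc)

∑ₗ : ∀ {A : Set} → (A → ℕ) → List A → ℕ
∑ₗ f R = sum (map f R)

module _ {A : Set} where

  ∑ₗ-↭ : ∀ (f : A → ℕ) {R R′} → R ↭ R′ → ∑ₗ f R ≡ ∑ₗ f R′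
  ∑ₗ-↭ f p = sum-↭ (map⁺ f p)

  ∑ₗ-mono : ∀ {f g : A → ℕ} R → (∀ {e} → e ∈ R → f e ≤ g e) → ∑ₗ f R ≤ ∑ₗ g R
  ∑ₗ-mono [] f≤g = z≤n
  ∑ₗ-mono (e ∷ R) f≤g = +-mono-≤ (f≤g (here refl)) (∑ₗ-mono R (f≤g ∘ there))

  -- Cancelling all other terms leaves no room for a strict inequality at `e`.
  ∑ₗ-tight : ∀ {f g : A → ℕ} R → (∀ {e} → e ∈ R → f e ≤ g e) → ∑ₗ g R ≤ ∑ₗ f R →
             ∀ {e} → e ∈ R → g e ≤ f e
  ∑ₗ-tight {f} {g} (x ∷ R) f≤g gR≤fR (here refl) =
    +-cancelʳ-≤ (∑ₗ g R) _ _ (≤-trans gR≤fR (+-monoʳ-≤ (f x) (∑ₗ-mono R (f≤g ∘ there))))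
  ∑ₗ-tight {f} {g} (x ∷ R) f≤g gR≤fR (there e∈) =
    ∑ₗ-tight R (f≤g ∘ there)
      (+-cancelˡ-≤ (g x) _ _ (≤-trans gR≤fR (+-monoˡ-≤ _ (f≤g (here refl))))) e∈

  ∑ₗ-+ : ∀ (f g : A → ℕ) R → ∑ₗ (λ e → f e + g e) R ≡ ∑ₗ f R + ∑ₗ g R
  ∑ₗ-+ f g [] = refl
  ∑ₗ-+ f g (e ∷ R) rewrite ∑ₗ-+ f g R = lemma (f e) (g e) (∑ₗ f R) (∑ₗ g R)
    where
    lemma : ∀ a b c d → (a + b) + (c + d) ≡ (a + c) + (b + d)
    lemma = solve-∀

  ∈⇒≤∑ₗ : ∀ (f : A → ℕ) {e R} → e ∈ R → f e ≤ ∑ₗ f R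
  ∈⇒≤∑ₗ f (here refl) = m≤m+n _ _
  ∈⇒≤∑ₗ f {R = e ∷ R} (there e∈) = ≤-trans (∈⇒≤∑ₗ f e∈) (m≤n+m _ (f e))

  0<∑ₗ⇒∃ : ∀ (f : A → ℕ) R → 0 < ∑ₗ f R → ∃[ e ] e ∈ R × 0 < f e
  0<∑ₗ⇒∃ f (e ∷ R) 0<s with f e in eq
  ... | suc _ = e , here refl , subst (0 <_) (sym eq) (s≤s z≤n)
  ... | zero with 0<∑ₗ⇒∃ f R 0<s
  ... | e′ , e′∈ , 0<f = e′ , there e′∈ , 0<f

-- The potential

Marking : ℕ → Set
Marking n = Fin n → Bool

touched : List (Edge n) → Marking n
touched T v = does (any? (incident? v) T)

meets : Fin n → Edge n → Bool
meets v e = does (incident? v e)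

mark : Edge n → Marking n → Marking n
mark e M v = meets v e ∨ M v

deg : List (Edge n) → Fin n → ℕ
deg R v = ∑ₗ (𝟙 ∘ meets v) R

-- For unmarked v, a lower bound for the growth of bonus M e when v gets marked.
load : Marking n → Fin n → Edge n → ℕ
load M v e = if meets v e then (if M (proj₁ e) ∨ M (proj₂ e) then 2 else 1) else 0

-- For an unmarked vertex of a simple graph, total 1 means a leaf with an unmarked neighbour; total
-- 2 means a leaf with a marked neighbour or a vertex of degree 2 with unmarked neighbours.
total : Marking n → List (Edge n) → Fin n → ℕ
total M R v = ∑ₗ (load M v) R

-- Marking the first end adds 1 and marking the second adds 2, the two nonzero values of `load`.
bonus′ : Bool → Bool → ℕ
bonus′ false false = 0
bonus′ true true = 3
bonus′ _ _ = 1

bonus : Marking n → Edge n → ℕ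
bonus M e = bonus′ (M (proj₁ e)) (M (proj₂ e))

isZero : ℕ → Bool
isZero zero = true
isZero (suc _) = false

unmarked : Marking n → Fin n → ℕ
unmarked M v = 𝟙 (not (M v))

isolated : Marking n → List (Edge n) → Fin n → ℕ
isolated M R v = if M v then 0 else 𝟙 (isZero (deg R v))

potᵥ : Marking n → List (Edge n) → Fin n → ℕ
potᵥ M R v = 4 * unmarked M v + isolated M R v

pot : Marking n → List (Edge n) → ℕ
pot M R = ∑ (potᵥ M R) + ∑ₗ (bonus M) R

score-∑ : (T : List (Edge n)) → score T ≡ ∑ (unmarked (touched T))
score-∑ T = length-filter-tabulate (λ v → ¬? (any? (incident? v) T)) (λ v → v)

-- With no edge left every unmarked vertex is isolated and weighs 4 + 1.
pot-[] : (T : List (Edge n)) → pot (touched T) [] ≡ 5 * score T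
pot-[] T = trans (+-identityʳ _) (trans (sum-cong-≗ lemma)
  (trans (∑-*ˡ 5 (unmarked (touched T))) (cong (5 *_) (sym (score-∑ T)))))
  where
  lemma : ∀ v → potᵥ (touched T) [] v ≡ 5 * unmarked (touched T) v
  lemma v with touched T v
  ... | true = refl
  ... | false = refl

deg-∷ : ∀ {R R′ : List (Edge n)} {e} → R ↭ e ∷ R′ → ∀ v → deg R v ≡ 𝟙 (meets v e) + deg R′ v
deg-∷ p v = ∑ₗ-↭ (𝟙 ∘ meets v) p

deg-≤ : ∀ {R R′ : List (Edge n)} {e} → R ↭ e ∷ R′ → ∀ v → deg R′ v ≤ deg R v
deg-≤ p v = ≤-trans (m≤n+m _ _) (≤-reflexive (sym (deg-∷ p v)))

meets⇒deg>0 : ∀ {R : List (Edge n)} {e} v → e ∈ R → meets v e ≡ true → 0 < deg R v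
meets⇒deg>0 v e∈ m = ≤-trans (≤-reflexive (cong 𝟙 (sym m))) (∈⇒≤∑ₗ (𝟙 ∘ meets v) e∈)

meetsˡ : (u v : Fin n) → meets u (u , v) ≡ true
meetsˡ u v rewrite dec-true (u ≟ u) refl = refl

meetsʳ : (u v : Fin n) → meets v (u , v) ≡ true
meetsʳ u v rewrite dec-true (v ≟ v) refl = ∨-zeroʳ _

isZero-anti : ∀ {a b} → b ≤ a → 𝟙 (isZero a) ≤ 𝟙 (isZero b)
isZero-anti {zero} z≤n = ≤-refl
isZero-anti {suc a} b≤a = z≤n

isolated-anti : ∀ (M : Marking n) {R R′} v → deg R′ v ≤ deg R v → isolated M R v ≤ isolated M R′ v
isolated-anti M v d with M v
... | true = z≤n
... | false = isZero-anti d

deg>0⇒isolated≡0 : ∀ (M : Marking n) {R} v → 0 < deg R v → isolated M R v ≡ 0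
deg>0⇒isolated≡0 M {R} v d with M v
... | true = refl
... | false with deg R v
... | suc _ = refl

-- Change of the potential under a claim

module _ {M : Marking n} {R R′ : List (Edge n)} {e : Edge n} (p : R ↭ e ∷ R′) where

  open ≤-Reasoning

  bonus-∷ : ∑ₗ (bonus M) R ≡ bonus M e + ∑ₗ (bonus M) R′
  bonus-∷ = ∑ₗ-↭ (bonus M) p

  -- The marks stay as they are and isolated vertices stay isolated, so only the bonus of `e` can be
  -- lost.
  isolate : pot M R ≤ pot M R′ + bonus M e
  isolate = begin
    ∑ (potᵥ M R) + ∑ₗ (bonus M) R
      ≤⟨ +-monoˡ-≤ _ (∑-mono (λ v → +-monoʳ-≤ (4 * unmarked M v) (isolated-anti M {R} {R′} v (deg-≤ p v)))) ⟩
    ∑ (potᵥ M R′) + ∑ₗ (bonus M) R           ≡⟨ cong (∑ (potᵥ M R′) +_) bonus-∷ ⟩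
    ∑ (potᵥ M R′) + (bonus M e + ∑ₗ (bonus M) R′)  ≡⟨ lemma (∑ (potᵥ M R′)) (bonus M e) _ ⟩
    pot M R′ + bonus M e ∎
    where
    lemma : ∀ a b c → a + (b + c) ≡ a + c + b
    lemma = solve-∀

  -- The claimed edge was the last one at `a`, whose isolation term rises from 0 to 1.
  isolate-leaf : ∀ {a} → M a ≡ false → deg R a ≡ 1 → meets a e ≡ true →
                 suc (pot M R) ≤ pot M R′ + bonus M e
  isolate-leaf {a} Ma d m = begin
    1 + (∑ (potᵥ M R) + ∑ₗ (bonus M) R)
      ≡⟨ lemma₁ (∑ (potᵥ M R)) _ ⟩
    (∑ (potᵥ M R) + 1) + ∑ₗ (bonus M) R
      ≡⟨ cong (_+ ∑ₗ (bonus M) R) (sym (∑-+δ (potᵥ M R) 1 a)) ⟩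
    ∑ (λ v → potᵥ M R v + 1 * δ a v) + ∑ₗ (bonus M) R
      ≤⟨ +-monoˡ-≤ _ (∑-mono vertex) ⟩
    ∑ (potᵥ M R′) + ∑ₗ (bonus M) R           ≡⟨ cong (∑ (potᵥ M R′) +_) bonus-∷ ⟩
    ∑ (potᵥ M R′) + (bonus M e + ∑ₗ (bonus M) R′)  ≡⟨ lemma₂ (∑ (potᵥ M R′)) (bonus M e) _ ⟩
    pot M R′ + bonus M e ∎
    where
    lemma₁ : ∀ a b → 1 + (a + b) ≡ a + 1 + b
    lemma₁ = solve-∀
    lemma₂ : ∀ a b c → a + (b + c) ≡ a + c + b
    lemma₂ = solve-∀
    d′ : deg R′ a ≡ 0
    d′ = suc-injective (trans (cong (λ b → 𝟙 b + deg R′ a) (sym m)) (trans (sym (deg-∷ p a)) d))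
    vertex : ∀ v → potᵥ M R v + 1 * δ a v ≤ potᵥ M R′ v
    vertex v with v ≟ a
    ... | no _ = ≤-trans (≤-reflexive (+-identityʳ _))
      (+-monoʳ-≤ (4 * unmarked M v) (isolated-anti M {R} {R′} v (deg-≤ p v)))
    ... | yes refl rewrite Ma | d | d′ = ≤-refl

-- The position of an end x of an edge relative to an edge uv with unmarked ends:
-- the indices are u ≡ x, v ≡ x, x ≡ u, x ≡ v and whether x is marked.
data Endpoint : (ux vx xu xv m : Bool) → Set where
  is-u  : Endpoint true false true false false
  is-v  : Endpoint false true false true false
  old   : ∀ m → Endpoint false false false false m

-- Both directions of each equality test are recorded because `load M u f` evaluates `u ≟ x`,
-- whereas `mark (u , v) M x` evaluates `x ≟ u`.
endpoint : ∀ (M : Marking n) {u v} → u ≢ v → M u ≡ false → M v ≡ false → ∀ x →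
  Endpoint (does (u ≟ x)) (does (v ≟ x)) (does (x ≟ u)) (does (x ≟ v)) (M x)
endpoint M {u} {v} u≢v Mu Mv x with u ≟ x | v ≟ x | x ≟ u | x ≟ v
... | yes refl | yes v≡u  | _       | _       = contradiction (sym v≡u) u≢v
... | yes refl | no v≢x   | no x≢u  | _       = contradiction refl x≢u
... | yes refl | no v≢x   | yes _   | yes eq  = contradiction eq u≢v
... | yes refl | no v≢x   | yes _   | no _    rewrite Mu = is-u
... | no u≢x   | yes refl | _       | no x≢v  = contradiction refl x≢v
... | no u≢x   | yes refl | yes x≡u | yes _   = contradiction (sym x≡u) u≢x
... | no u≢x   | yes refl | no _    | yes _   rewrite Mv = is-v
... | no u≢x   | no v≢x   | yes x≡u | _       = contradiction (sym x≡u) u≢x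
... | no u≢x   | no v≢x   | no _    | yes x≡v = contradiction (sym x≡v) v≢x
... | no u≢x   | no v≢x   | no _    | no _    = old (M x)

-- A finite table for one edge `xy`: marking `u` and `v` raises its bonus by at least their two
-- loads. There is slack only when both ends are among `u` and `v`.
bonus-load : ∀ {ux vx xu xv mx uy vy yu yv my} →
  Endpoint ux vx xu xv mx → Endpoint uy vy yu yv my →
  bonus′ mx my + ((if ux ∨ uy then (if mx ∨ my then 2 else 1) else 0)
                + (if vx ∨ vy then (if mx ∨ my then 2 else 1) else 0))
    ≤ bonus′ ((xu ∨ xv) ∨ mx) ((yu ∨ yv) ∨ my)
bonus-load is-u is-u = s≤s z≤n
bonus-load is-u is-v = s≤s (s≤s z≤n)
bonus-load is-u (old true) = ≤-refl
bonus-load is-u (old false) = ≤-refl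
bonus-load is-v is-u = s≤s (s≤s z≤n)
bonus-load is-v is-v = s≤s z≤n
bonus-load is-v (old true) = ≤-refl
bonus-load is-v (old false) = ≤-refl
bonus-load (old true) is-u = ≤-refl
bonus-load (old false) is-u = ≤-refl
bonus-load (old true) is-v = ≤-refl
bonus-load (old false) is-v = ≤-refl
bonus-load (old true) (old true) = ≤-refl
bonus-load (old true) (old false) = ≤-refl
bonus-load (old false) (old true) = ≤-refl
bonus-load (old false) (old false) = ≤-refl

bonus′-mono : ∀ p q a b → bonus′ a b ≤ bonus′ (p ∨ a) (q ∨ b)
bonus′-mono p q false false = z≤n
bonus′-mono p q true true rewrite ∨-zeroʳ p | ∨-zeroʳ q = ≤-refl
bonus′-mono p false true false rewrite ∨-zeroʳ p = ≤-refl
bonus′-mono p true true false rewrite ∨-zeroʳ p = s≤s z≤n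
bonus′-mono false q false true rewrite ∨-zeroʳ q = ≤-refl
bonus′-mono true q false true rewrite ∨-zeroʳ q = s≤s z≤n

module _ {M : Marking n} {R R′ : List (Edge n)} {u v : Fin n} (p : R ↭ (u , v) ∷ R′) where

  open ≤-Reasoning

  private
    M′ : Marking n
    M′ = mark (u , v) M

    a+0≡a*1 : ∀ a → a + 0 ≡ a * 1
    a+0≡a*1 = solve-∀

    uv∈ : (u , v) ∈ R
    uv∈ = ∈-resp-↭ (↭-sym p) (here refl)

  -- Only `u` and `v` can lose weight. Neither was isolated while `uv` was unclaimed, so each loses
  -- at most its 4, and nothing if it was marked already.
  touch-vertex : ∀ x → potᵥ M R x ≤ (potᵥ M′ R′ x + 4 * unmarked M u * δ u x) + 4 * unmarked M v * δ v x
  touch-vertex x with x ≟ u | x ≟ v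
  ... | yes refl | _ rewrite deg>0⇒isolated≡0 M {R} u (meets⇒deg>0 u uv∈ (meetsˡ u v)) =
    ≤-trans (≤-reflexive (a+0≡a*1 (4 * unmarked M u))) (m≤m+n _ _)
  ... | no _ | yes refl rewrite deg>0⇒isolated≡0 M {R} v (meets⇒deg>0 v uv∈ (meetsʳ u v)) =
    ≤-trans (≤-reflexive (a+0≡a*1 (4 * unmarked M v))) (m≤n+m _ (4 * unmarked M u * 0))
  ... | no _ | no _ = begin
    4 * unmarked M x + isolated M R x  ≤⟨ +-monoʳ-≤ (4 * unmarked M x) (isolated-anti M {R} {R′} x (deg-≤ p x)) ⟩
    potᵥ M R′ x ≤⟨ m≤m+n _ _ ⟩
    potᵥ M R′ x + 4 * unmarked M u * 0 ≤⟨ m≤m+n _ _ ⟩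
    potᵥ M R′ x + 4 * unmarked M u * 0 + 4 * unmarked M v * 0 ∎

  touch-vertices : ∑ (potᵥ M R) ≤ ∑ (potᵥ M′ R′) + 4 * unmarked M u + 4 * unmarked M v
  touch-vertices = begin
    ∑ (potᵥ M R) ≤⟨ ∑-mono touch-vertex ⟩
    ∑ (λ x → (potᵥ M′ R′ x + 4 * unmarked M u * δ u x) + 4 * unmarked M v * δ v x)
      ≡⟨ ∑-+δ (λ x → potᵥ M′ R′ x + 4 * unmarked M u * δ u x) _ v ⟩
    ∑ (λ x → potᵥ M′ R′ x + 4 * unmarked M u * δ u x) + 4 * unmarked M v
      ≡⟨ cong (_+ 4 * unmarked M v) (∑-+δ (potᵥ M′ R′) _ u) ⟩
    ∑ (potᵥ M′ R′) + 4 * unmarked M u + 4 * unmarked M v ∎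

  -- With one marked end the loss is 4 for the other end and 1 for the bonus of the edge; with two
  -- marked ends only the bonus of 3 is lost. Both fit into 6.
  touch-marked : M u ∨ M v ≡ true → pot M R ≤ pot M′ R′ + 6
  touch-marked Muv = begin
    ∑ (potᵥ M R) + ∑ₗ (bonus M) R
      ≤⟨ +-mono-≤ touch-vertices (≤-trans (≤-reflexive (∑ₗ-↭ (bonus M) p))
          (+-monoʳ-≤ (bonus M (u , v)) (∑ₗ-mono R′ (λ _ → bonus′-mono _ _ _ _)))) ⟩
    (∑ (potᵥ M′ R′) + 4 * unmarked M u + 4 * unmarked M v) + (bonus M (u , v) + ∑ₗ (bonus M′) R′)
      ≡⟨ lemma (∑ (potᵥ M′ R′)) (4 * unmarked M u) (4 * unmarked M v) (bonus M (u , v)) _ ⟩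
    pot M′ R′ + (4 * unmarked M u + 4 * unmarked M v + bonus M (u , v))
      ≤⟨ +-monoʳ-≤ (pot M′ R′) (cost (M u) (M v) Muv) ⟩
    pot M′ R′ + 6 ∎
    where
    lemma : ∀ a b c d e → (a + b + c) + (d + e) ≡ (a + e) + (b + c + d)
    lemma = solve-∀
    cost : ∀ a b → a ∨ b ≡ true → 4 * 𝟙 (not a) + 4 * 𝟙 (not b) + bonus′ a b ≤ 6
    cost true  true  _ = m≤m+n 3 3
    cost true  false _ = m≤m+n 5 1
    cost false true  _ = m≤m+n 5 1

  -- The vertices cost 4 + 4. The remaining edges repay at least their loads at `u` and `v`, and the
  -- other 2 accounts for the claimed edge, which is counted with load 1 in each total but repays
  -- nothing.
  touch-unmarked : u ≢ v → M u ≡ false → M v ≡ false →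
                   pot M R + (total M R u + total M R v) ≤ pot M′ R′ + 10
  touch-unmarked u≢v Mu Mv = begin
    (∑ (potᵥ M R) + ∑ₗ (bonus M) R) + (total M R u + total M R v)
      ≡⟨ cong₂ (λ a b → (∑ (potᵥ M R) + a) + b) (∑ₗ-↭ (bonus M) p)
          (cong₂ _+_ (∑ₗ-↭ (load M u) p) (∑ₗ-↭ (load M v) p)) ⟩
    (∑ (potᵥ M R) + (bonus M (u , v) + ∑ₗ (bonus M) R′))
      + ((load M u (u , v) + total M R′ u) + (load M v (u , v) + total M R′ v))
      ≡⟨ lemma₁ (∑ (potᵥ M R)) (bonus M (u , v)) _ _ _ _ _ ⟩
    ∑ (potᵥ M R) + (bonus M (u , v) + load M u (u , v) + load M v (u , v))
      + (∑ₗ (bonus M) R′ + (total M R′ u + total M R′ v))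
      ≤⟨ +-mono-≤ (+-mono-≤ vertices (≤-reflexive this)) edges ⟩
    (∑ (potᵥ M′ R′) + 4 + 4) + 2 + ∑ₗ (bonus M′) R′
      ≡⟨ lemma₂ (∑ (potᵥ M′ R′)) _ ⟩
    pot M′ R′ + 10 ∎
    where
    lemma₁ : ∀ a b c d e f g → (a + (b + c)) + ((d + e) + (f + g)) ≡ a + (b + d + f) + (c + (e + g))
    lemma₁ = solve-∀
    lemma₂ : ∀ a b → (a + 4 + 4) + 2 + b ≡ a + b + 10
    lemma₂ = solve-∀
    vertices : ∑ (potᵥ M R) ≤ ∑ (potᵥ M′ R′) + 4 + 4
    vertices = subst (λ b → ∑ (potᵥ M R) ≤ ∑ (potᵥ M′ R′) + 4 + 4 * 𝟙 (not b)) Mv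
      (subst (λ b → ∑ (potᵥ M R) ≤ ∑ (potᵥ M′ R′) + 4 * 𝟙 (not b) + 4 * unmarked M v) Mu touch-vertices)
    this : bonus M (u , v) + load M u (u , v) + load M v (u , v) ≡ 2
    this rewrite Mu | Mv | dec-true (u ≟ u) refl | dec-true (v ≟ v) refl | ∨-zeroʳ (does (v ≟ u)) = refl
    edges : ∑ₗ (bonus M) R′ + (total M R′ u + total M R′ v) ≤ ∑ₗ (bonus M′) R′
    edges = begin
      ∑ₗ (bonus M) R′ + (total M R′ u + total M R′ v)
        ≡⟨ cong (∑ₗ (bonus M) R′ +_) (sym (∑ₗ-+ (load M u) (load M v) R′)) ⟩
      ∑ₗ (bonus M) R′ + ∑ₗ (λ f → load M u f + load M v f) R′
        ≡⟨ sym (∑ₗ-+ (bonus M) (λ f → load M u f + load M v f) R′) ⟩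
      ∑ₗ (λ f → bonus M f + (load M u f + load M v f)) R′
        ≤⟨ ∑ₗ-mono R′ (λ {f} _ → bonus-load (endpoint M u≢v Mu Mv (proj₁ f)) (endpoint M u≢v Mu Mv (proj₂ f))) ⟩
      ∑ₗ (bonus M′) R′ ∎

-- Forests

does⇒ : ∀ {P : Set} (d : Dec P) → does d ≡ true → P
does⇒ (yes p) _ = p

¬does⇒ : ∀ {P : Set} (d : Dec P) → does d ≡ false → ¬ P
¬does⇒ (no ¬p) _ = ¬p

module _ {A : Set} where

  ∈⇒↭ : ∀ {x : A} {xs} → x ∈ xs → ∃[ ys ] xs ↭ x ∷ ys
  ∈⇒↭ {x} x∈ with as , bs , refl ← ∈-∃++ x∈ = as ++ bs , shift x as bs

  Unique-resp-↭ : ∀ {xs ys : List A} → xs ↭ ys → Unique xs → Unique ys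
  Unique-resp-↭ p = PermSetoid.Unique-resp-↭ (setoid A) (↭⇒↭ₛ p)

  Unique-++ˡ : ∀ (xs : List A) {ys} → Unique (xs ++ ys) → Unique xs
  Unique-++ˡ [] _ = []
  Unique-++ˡ (x ∷ xs) (x∉ ∷ u) = All-++ˡ xs x∉ ∷ Unique-++ˡ xs u
    where
    All-++ˡ : ∀ {P : A → Set} xs {ys} → All P (xs ++ ys) → All P xs
    All-++ˡ [] _ = []
    All-++ˡ (x ∷ xs) (p ∷ ps) = p ∷ All-++ˡ xs ps

  Linked-++ˡ : ∀ {R : A → A → Set} (xs : List A) {y ys} → Linked R (xs ++ y ∷ ys) → Linked R (xs ++ y ∷ [])
  Linked-++ˡ [] _ = [-]
  Linked-++ˡ (x ∷ []) (r ∷ l) = r ∷ [-]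
  Linked-++ˡ (x ∷ z ∷ zs) (r ∷ l) = r ∷ Linked-++ˡ (z ∷ zs) l

  lookup-injective : ∀ {xs : List A} → Unique xs → ∀ {i j} → lookup xs i ≡ lookup xs j → i ≡ j
  lookup-injective (_ ∷ _) {zero} {zero} _ = refl
  lookup-injective {_ ∷ xs} (x∉ ∷ _) {zero} {suc j} eq = contradiction eq (All.lookup x∉ (∈-lookup j))
  lookup-injective {_ ∷ xs} (x∉ ∷ _) {suc i} {zero} eq = contradiction (sym eq) (All.lookup x∉ (∈-lookup i))
  lookup-injective (_ ∷ u) {suc i} {suc j} eq = cong suc (lookup-injective u eq)

Unique-length : ∀ {xs : List (Fin n)} → Unique xs → length xs ≤ n
Unique-length u = Fin.injective⇒≤ (lookup-injective u)

Forest : List (Edge n) → Set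
Forest R = IsSimple R × Acyclic R

Adj-mono : ∀ {R R′ : List (Edge n)} → (∀ {e} → e ∈ R′ → e ∈ R) → ∀ {u v} → Adj R′ u v → Adj R u v
Adj-mono sub = Sum.map sub sub

Forest-∷ : ∀ {R R′ : List (Edge n)} {e} → R ↭ e ∷ R′ → Forest R → Forest R′
Forest-∷ p ((ord , uniq) , acyc) with _ ∷ ord′ ← All-resp-↭ p ord | _ ∷ uniq′ ← Unique-resp-↭ p uniq =
  (ord′ , uniq′) , λ (v , ws , 2≤ , u , l) →
    acyc (v , ws , 2≤ , u , Linked.map (Adj-mono (∈-resp-↭ (↭-sym p) ∘ there)) l)

Joins : Edge n → Fin n → Fin n → Set
Joins e v w = e ≡ (v , w) ⊎ e ≡ (w , v)

Joins⇒Adj : ∀ {R : List (Edge n)} {e v w} → e ∈ R → Joins e v w → Adj R v w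
Joins⇒Adj e∈ (inj₁ refl) = inj₁ e∈
Joins⇒Adj e∈ (inj₂ refl) = inj₂ e∈

Adj⇒Joins : ∀ {R : List (Edge n)} {v w} → Adj R v w → ∃[ e ] e ∈ R × Joins e v w
Adj⇒Joins (inj₁ e∈) = _ , e∈ , inj₁ refl
Adj⇒Joins (inj₂ e∈) = _ , e∈ , inj₂ refl

Joins⇒meets : ∀ {e : Edge n} {v w} → Joins e v w → meets v e ≡ true
Joins⇒meets {v = v} {w} (inj₁ refl) = meetsˡ v w
Joins⇒meets {v = v} {w} (inj₂ refl) = meetsʳ w v

meets⇒Joins : ∀ {e : Edge n} v → meets v e ≡ true → ∃[ w ] Joins e v w
meets⇒Joins {e = x , y} v m with does⇒ (incident? v (x , y)) m
... | inj₁ refl = y , inj₁ refl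
... | inj₂ refl = x , inj₂ refl

¬meets : ∀ {e : Edge n} {v} → v ≢ proj₁ e → v ≢ proj₂ e → meets v e ≡ false
¬meets {e = e} {v} v≢x v≢y = dec-false (incident? v e) λ { (inj₁ eq) → v≢x eq ; (inj₂ eq) → v≢y eq }

¬meets⇒≢₁ : ∀ {e : Edge n} {v} → meets v e ≡ false → proj₁ e ≢ v
¬meets⇒≢₁ {e = e} {v} m eq = ¬does⇒ (incident? v e) m (inj₁ (sym eq))

¬meets⇒≢₂ : ∀ {e : Edge n} {v} → meets v e ≡ false → proj₂ e ≢ v
¬meets⇒≢₂ {e = e} {v} m eq = ¬does⇒ (incident? v e) m (inj₂ (sym eq))

deg>0⇒∃ : ∀ {R : List (Edge n)} v → 0 < deg R v → ∃[ e ] e ∈ R × meets v e ≡ true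
deg>0⇒∃ {R = R} v d with 0<∑ₗ⇒∃ (𝟙 ∘ meets v) R d
... | e , e∈ , 0<m with meets v e in eq
... | true = e , e∈ , eq

deg≡0⇒¬meets : ∀ {R : List (Edge n)} v → deg R v ≡ 0 → ∀ {e} → e ∈ R → meets v e ≡ false
deg≡0⇒¬meets v d {e} e∈ with meets v e in eq
... | false = refl
... | true = contradiction (subst (0 <_) d (meets⇒deg>0 v e∈ eq)) λ ()

deg-meets : ∀ {R R′ : List (Edge n)} {e} → R ↭ e ∷ R′ → ∀ v → meets v e ≡ true → deg R v ≡ suc (deg R′ v)
deg-meets {R′ = R′} p v m = trans (deg-∷ p v) (cong (λ b → 𝟙 b + deg R′ v) m)

deg≡1⇒unique-edge : ∀ {R : List (Edge n)} v → deg R v ≡ 1 → ∀ {e f} → e ∈ R → f ∈ R →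
  meets v e ≡ true → meets v f ≡ true → f ≡ e
deg≡1⇒unique-edge v d e∈ f∈ me mf with ∈⇒↭ e∈
... | R′ , p with ∈-resp-↭ p f∈
... | here eq = eq
... | there f∈′ = contradiction
  (subst (0 <_) (suc-injective (trans (sym (deg-meets p v me)) d)) (meets⇒deg>0 v f∈′ mf)) λ ()

module _ {R : List (Edge n)} (simple : IsSimple R) where

  private
    ordered : ∀ {x y} → (x , y) ∈ R → x Fin.< y
    ordered = All.lookup (proj₁ simple)

  ends-≢ : ∀ {e} → e ∈ R → proj₁ e ≢ proj₂ e
  ends-≢ e∈ = Fin.<⇒≢ (ordered e∈)

  Adj⇒≢ : ∀ {v w} → Adj R v w → v ≢ w
  Adj⇒≢ (inj₁ e∈) = ends-≢ e∈
  Adj⇒≢ (inj₂ e∈) = ends-≢ e∈ ∘ sym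

  Joins-unique : ∀ {e f v w} → e ∈ R → f ∈ R → Joins e v w → Joins f v w → f ≡ e
  Joins-unique e∈ f∈ (inj₁ refl) (inj₁ refl) = refl
  Joins-unique e∈ f∈ (inj₁ refl) (inj₂ refl) = contradiction (ordered f∈) (Fin.<-asym (ordered e∈))
  Joins-unique e∈ f∈ (inj₂ refl) (inj₁ refl) = contradiction (ordered f∈) (Fin.<-asym (ordered e∈))
  Joins-unique e∈ f∈ (inj₂ refl) (inj₂ refl) = refl

  -- After removing the edge to `p` another edge remains at `v`; it cannot lead to `p` again, since
  -- a simple graph has no parallel edges.
  second-neighbour : ∀ {v p} → Adj R v p → 2 ≤ deg R v → ∃[ q ] q ≢ p × Adj R v q
  second-neighbour {v} {p} adj 2≤d with Adj⇒Joins adj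
  ... | e , e∈ , j with ∈⇒↭ e∈
  ... | R′ , perm with deg>0⇒∃ {R = R′} v (≤-pred (subst (2 ≤_) (deg-meets perm v (Joins⇒meets j)) 2≤d))
  ... | f , f∈ , m with meets⇒Joins v m
  ... | q , jf = q , q≢p , Joins⇒Adj f∈R jf
    where
    f∈R : f ∈ R
    f∈R = ∈-resp-↭ (↭-sym perm) (there f∈)
    q≢p : q ≢ p
    q≢p refl with e∉ ∷ _ ← Unique-resp-↭ perm (proj₂ simple) =
      contradiction (sym (Joins-unique e∈ f∈R j jf)) (All.lookup e∉ f∈)

-- A walk that never turns back and never gets stuck closes a cycle.
module _ {R : List (Edge n)} (simple : IsSimple R) (S : Fin n → Set)
  (closed : ∀ {v w} → Adj R v w → S v → S w) (a : Fin n)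
  (next : ∀ {v p} → v ≢ a → S v → Adj R v p → ∃[ q ] q ≢ p × Adj R v q) where

  private
    -- The path is stored with its newest vertex first. Keeping `a` among the older vertices makes
    -- `v` differ from `a`, as `next` demands; fuel and length together exceed `n`, so running out
    -- of fuel would leave too many distinct vertices.
    walk : ∀ fuel v p ws → n < fuel + length (v ∷ p ∷ ws) → Unique (v ∷ p ∷ ws) →
           Linked (Adj R) (v ∷ p ∷ ws) → a ∈ p ∷ ws → S v → Cycle R
    walk zero v p ws n< u _ _ _ = contradiction (Unique-length u) (<⇒≱ n<)
    walk (suc fuel) v p ws n< u@(v∉ ∷ _) l@(adj ∷ _) a∈ s
      with next (λ v≡a → All.lookup v∉ a∈ v≡a) s adj
    ... | q , q≢p , adj′ with any? (q ≟_) ws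
    ... | no q∉ws = walk fuel q v (p ∷ ws) (subst (n <_) (sym (+-suc fuel _)) n<)
            (All.tabulate q∉ ∷ u) (Sum.swap adj′ ∷ l) (there a∈) (closed adj′ s)
      where
      q∉ : ∀ {x} → x ∈ v ∷ p ∷ ws → q ≢ x
      q∉ (here refl) q≡ = Adj⇒≢ simple adj′ (sym q≡)
      q∉ (there (here refl)) = q≢p
      q∉ (there (there x∈)) refl = q∉ws x∈
    -- The walk has returned to `q`, so the stretch since the earlier visit, which contains at least
    -- `v` and `p`, closes a cycle.
    ... | yes q∈ws with as , bs , refl ← ∈-∃++ q∈ws =
      q , v ∷ p ∷ as , s≤s (s≤s z≤n) ,
      Unique-++ˡ (q ∷ v ∷ p ∷ as) (Unique-resp-↭ (shift q (v ∷ p ∷ as) bs) u) ,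
      Sum.swap adj′ ∷ Linked-++ˡ (v ∷ p ∷ as) l

  closed-walk : ∀ {w} → Adj R a w → S a → Cycle R
  closed-walk {w} adj s = walk n w a [] (m<m+n n (s≤s z≤n))
    (((λ w≡a → Adj⇒≢ simple adj (sym w≡a)) ∷ []) ∷ [] ∷ []) (Sum.swap adj ∷ [-]) (here refl) (closed adj s)

-- Unions of components and their marked vertices

Closed : (Fin n → Bool) → List (Edge n) → Set
Closed S R = ∀ {e} → e ∈ R → S (proj₁ e) ≡ S (proj₂ e)

-- Every component of R that has an edge contains a marked vertex.
Anchored : Marking n → List (Edge n) → Set
Anchored {n} M R = ∀ (S : Fin n → Bool) → (∀ v → S v ≡ true → M v ≡ false) → Closed S R →
  ∀ {e} → e ∈ R → S (proj₁ e) ≡ false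

∨-falseʳ : ∀ a {b} → a ∨ b ≡ false → b ≡ false
∨-falseʳ false eq = eq

∨-falseˡ : ∀ a {b} → a ∨ b ≡ false → a ≡ false
∨-falseˡ false eq = refl

mark-first : ∀ (M : Marking n) e → mark e M (proj₁ e) ≡ true
mark-first M (x , y) rewrite meetsˡ x y = refl

mark-second : ∀ (M : Marking n) e → mark e M (proj₂ e) ≡ true
mark-second M (x , y) rewrite meetsʳ x y = refl

module _ {M : Marking n} {R R′ : List (Edge n)} {e : Edge n} (p : R ↭ e ∷ R′) where

  -- Both ends of `e` are marked now, hence outside `S`; putting `e` back does not cross the
  -- boundary of `S`.
  touch-closed : ∀ S → (∀ v → S v ≡ true → mark e M v ≡ false) → Closed S R′ → Closed S R
  touch-closed S off-M cl f∈ with ∈-resp-↭ p f∈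
  ... | there f∈′ = cl f∈′
  ... | here refl = trans (off (mark-first M e)) (sym (off (mark-second M e)))
    where
    off : ∀ {v} → mark e M v ≡ true → S v ≡ false
    off {v} m with S v in eq
    ... | false = refl
    ... | true with () ← trans (sym m) (off-M v eq)

  touch-anchored : Anchored M R → Anchored (mark e M) R′
  touch-anchored anchored S off-M cl f∈ =
    anchored S (λ v s → ∨-falseʳ (meets v e) (off-M v s)) (touch-closed S off-M cl) (∈-resp-↭ (↭-sym p) (there f∈))

  -- Giving the leaf `a` the same side as its neighbour `w` turns `S` into a set closed in `R`. It
  -- still avoids marked vertices because `a` is unmarked, and the edges of `R′` do not see the
  -- change.
  leaf-anchored : ∀ {a} → proj₁ e ≢ proj₂ e → M a ≡ false → deg R a ≡ 1 → meets a e ≡ true → Anchored M R → Anchored M R′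
  leaf-anchored {a} e-≢ Ma d m anchored S off-M cl {f} f∈ with meets⇒Joins a m
  ... | w , j = trans (sym (S′≡S (¬meets⇒≢₁ {e = f} (off f∈)))) (anchored S′ off-M′ cl′ (∈-resp-↭ (↭-sym p) (there f∈)))
    where
    S′ : Fin n → Bool
    S′ v = if does (v ≟ a) then S w else S v
    off : ∀ {f} → f ∈ R′ → meets a f ≡ false
    off = deg≡0⇒¬meets a (suc-injective (trans (sym (deg-meets p a m)) d))
    S′≡S : ∀ {v} → v ≢ a → S′ v ≡ S v
    S′≡S {v} v≢a rewrite dec-false (v ≟ a) v≢a = refl
    S′a : S′ a ≡ S w
    S′a rewrite dec-true (a ≟ a) refl = refl
    w≢a : ∀ {e} → proj₁ e ≢ proj₂ e → Joins e a w → w ≢ a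
    w≢a ne (inj₁ refl) refl = ne refl
    w≢a ne (inj₂ refl) refl = ne refl
    S′w : S′ w ≡ S w
    S′w = S′≡S (w≢a e-≢ j)
    off-M′ : ∀ v → S′ v ≡ true → M v ≡ false
    off-M′ v s with v ≟ a
    ... | yes refl = Ma
    ... | no _ = off-M v s
    ends : ∀ {e} → Joins e a w → S′ (proj₁ e) ≡ S′ (proj₂ e)
    ends (inj₁ refl) = trans S′a (sym S′w)
    ends (inj₂ refl) = trans S′w (sym S′a)
    cl′ : Closed S′ R
    cl′ f∈ with ∈-resp-↭ p f∈
    ... | here refl = ends j
    ... | there {_} {xs} f∈′ = trans (S′≡S (¬meets⇒≢₁ (off f∈′))) (trans (cl f∈′) (sym (S′≡S (¬meets⇒≢₂ (off f∈′)))))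

NoLeaf : Marking n → List (Edge n) → Set
NoLeaf M R = ∀ v → M v ≡ false → 0 < deg R v → 2 ≤ deg R v

module _ {M : Marking n} {R R′ : List (Edge n)} {e : Edge n} (p : R ↭ e ∷ R′)
  (forest : Forest R) (noLeaf : NoLeaf M R) where

  -- A one-sided component left by the cut would be a tree with at most one leaf.
  private
    no-side : ∀ {a b} → Joins e a b → ∀ S → (∀ v → S v ≡ true → M v ≡ false) → Closed S R′ →
              S a ≡ true → S b ≡ false → Cycle R′
    no-side {a} {b} j S off-M cl Sa Sb with deg>0⇒∃ {R = R′} a (≤-pred (subst (2 ≤_) (deg-meets p a (Joins⇒meets j))
        (noLeaf a (off-M a Sa) (≤-trans (s≤s z≤n) (≤-reflexive (sym (deg-meets p a (Joins⇒meets j))))))))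
    ... | f , f∈ , m with meets⇒Joins a m
    ... | w , jf = closed-walk simple′ (λ v → S v ≡ true) closed a next (Joins⇒Adj f∈ jf) Sa
      where
      simple′ : IsSimple R′
      simple′ = proj₁ (Forest-∷ p forest)
      closed : ∀ {v w} → Adj R′ v w → S v ≡ true → S w ≡ true
      closed (inj₁ g∈) s = trans (sym (cl g∈)) s
      closed (inj₂ g∈) s = trans (cl g∈) s
      away : ∀ {e v} → Joins e a b → v ≢ a → v ≢ b → meets v e ≡ false
      away (inj₁ refl) v≢a v≢b = ¬meets v≢a v≢b
      away (inj₂ refl) v≢a v≢b = ¬meets v≢b v≢a
      next : ∀ {v q} → v ≢ a → S v ≡ true → Adj R′ v q → ∃[ r ] r ≢ q × Adj R′ v r
      next {v} {q} v≢a Sv adj = second-neighbour simple′ adj (subst (2 ≤_) same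
          (noLeaf v (off-M v Sv) (subst (0 <_) (sym same) 0<d)))
        where
        v≢b : v ≢ b
        v≢b refl with () ← trans (sym Sv) Sb
        same : deg R v ≡ deg R′ v
        same = trans (deg-∷ p v) (cong (λ x → 𝟙 x + deg R′ v) (away j v≢a v≢b))
        0<d : 0 < deg R′ v
        0<d with g , g∈ , jg ← Adj⇒Joins adj = meets⇒deg>0 v g∈ (Joins⇒meets jg)

    rejoin : ∀ S → S (proj₁ e) ≡ S (proj₂ e) → Closed S R′ → Closed S R
    rejoin S eq cl f∈ with ∈-resp-↭ p f∈
    ... | here refl = eq
    ... | there f∈′ = cl f∈′

  -- If `S` does not separate the ends of `e`, it is closed in `R` as well; if it does, its unmarked
  -- side would contain a cycle.
  cut-anchored : Anchored M R → Anchored M R′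
  cut-anchored anchored S off-M cl f∈ with S (proj₁ e) in Sx | S (proj₂ e) in Sy
  ... | true | false = contradiction (no-side (inj₁ refl) S off-M cl Sx Sy) (proj₂ (Forest-∷ p forest))
  ... | false | true = contradiction (no-side (inj₂ refl) S off-M cl Sy Sx) (proj₂ (Forest-∷ p forest))
  ... | true | true = anchored S off-M (rejoin S (trans Sx (sym Sy)) cl) (∈-resp-↭ (↭-sym p) (there f∈))
  ... | false | false = anchored S off-M (rejoin S (trans Sx (sym Sy)) cl) (∈-resp-↭ (↭-sym p) (there f∈))

-- Loads and the cost of a claim by Toucher

module _ (M : Marking n) (v : Fin n) where

  meets≤load : ∀ e → 𝟙 (meets v e) ≤ load M v e
  meets≤load (x , y) with meets v (x , y) | M x ∨ M y
  ... | false | _ = z≤n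
  ... | true | true = s≤s z≤n
  ... | true | false = ≤-refl

  load-unmarked : ∀ e → M (proj₁ e) ≡ false → M (proj₂ e) ≡ false → load M v e ≤ 1
  load-unmarked (x , y) Mx My with meets v (x , y)
  ... | false = z≤n
  ... | true rewrite Mx | My = ≤-refl

  load-away : ∀ e → meets v e ≡ false → load M v e ≡ 0
  load-away (x , y) m rewrite m = refl

  load≤1⇒unmarked : ∀ e → meets v e ≡ true → load M v e ≤ 1 → M (proj₁ e) ∨ M (proj₂ e) ≡ false
  load≤1⇒unmarked (x , y) m l rewrite m with M x ∨ M y
  ... | false = refl
  ... | true with s≤s () ← l

  load-mark : ∀ e f → load M v f ≤ load (mark e M) v f
  load-mark e (x , y) with meets v (x , y)
  ... | false = z≤n
  ... | true with meets x e | meets y e | M x | M y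
  ... | false | false | _     | _     = ≤-refl
  ... | true  | _     | true  | _     = ≤-refl
  ... | true  | _     | false | true  = ≤-refl
  ... | true  | _     | false | false = s≤s z≤n
  ... | false | true  | true  | _     = ≤-refl
  ... | false | true  | false | true  = ≤-refl
  ... | false | true  | false | false = s≤s z≤n

  deg≤total : ∀ R → deg R v ≤ total M R v
  deg≤total R = ∑ₗ-mono R (λ {e} _ → meets≤load e)

  total-∷ : ∀ {R R′ e} → R ↭ e ∷ R′ → total M R v ≡ load M v e + total M R′ v
  total-∷ p = ∑ₗ-↭ (load M v) p

  total-away : ∀ {R R′ e} → R ↭ e ∷ R′ → meets v e ≡ false → total M R v ≡ total M R′ v
  total-away {R′ = R′} {e} p m = trans (total-∷ p) (cong (_+ total M R′ v) (load-away e m))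

  deg≡0⇒total≡0 : ∀ {R} → deg R v ≡ 0 → total M R v ≡ 0
  deg≡0⇒total≡0 {[]} _ = refl
  deg≡0⇒total≡0 {e ∷ R} d with meets v e in m
  ... | false = deg≡0⇒total≡0 {R} d

-- No unmarked leaf has an unmarked neighbour; hence no move of Toucher costs 7.
Calm : Marking n → List (Edge n) → Set
Calm M R = ∀ v → M v ≡ false → 0 < deg R v → 2 ≤ total M R v

module _ {M : Marking n} {R R′ : List (Edge n)} {u v : Fin n} (simple : IsSimple R) (p : R ↭ (u , v) ∷ R′) where

  private
    M′ : Marking n
    M′ = mark (u , v) M

    uv∈ : (u , v) ∈ R
    uv∈ = ∈-resp-↭ (↭-sym p) (here refl)

    deg-u : 0 < deg R u
    deg-u = meets⇒deg>0 u uv∈ (meetsˡ u v)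

    deg-v : 0 < deg R v
    deg-v = meets⇒deg>0 v uv∈ (meetsʳ u v)

    u≢v : u ≢ v
    u≢v = ends-≢ simple uv∈

  -- With two unmarked ends the cost is at most 10 minus the two totals, so totals that fall short
  -- of 4 by at most `c` leave a cost of at most 6 + `c`.
  touch-loss : ∀ {c} → (M u ≡ false → M v ≡ false → 4 ≤ total M R u + total M R v + c) →
               pot M R ≤ pot M′ R′ + (6 + c)
  touch-loss {c} big with M u ∨ M v in eq
  ... | true = ≤-trans (touch-marked p eq) (+-monoʳ-≤ (pot M′ R′) (m≤m+n 6 c))
  ... | false = +-cancelʳ-≤ 4 _ _ (begin
    pot M R + 4 ≤⟨ +-monoʳ-≤ (pot M R) (big Mu Mv) ⟩
    pot M R + (total M R u + total M R v + c) ≡⟨ sym (+-assoc (pot M R) _ c) ⟩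
    pot M R + (total M R u + total M R v) + c ≤⟨ +-monoˡ-≤ c (touch-unmarked p u≢v Mu Mv) ⟩
    pot M′ R′ + 10 + c ≡⟨ lemma (pot M′ R′) c ⟩
    pot M′ R′ + (6 + c) + 4 ∎)
    where
    open ≤-Reasoning
    Mu = ∨-falseˡ (M u) eq
    Mv = ∨-falseʳ (M u) eq
    lemma : ∀ a c → a + 10 + c ≡ a + (6 + c) + 4
    lemma = solve-∀

  touch-loss-calm : Calm M R → pot M R ≤ pot M′ R′ + 6
  touch-loss-calm calm = touch-loss λ Mu Mv →
    ≤-trans (+-mono-≤ (calm u Mu deg-u) (calm v Mv deg-v)) (m≤m+n _ 0)

  -- Each total is at least 1. If they summed to 2, both ends would have degree 1 and `uv` would be
  -- a whole component.
  touch-loss-connected : (M u ≡ false → M v ≡ false → ¬ Closed (λ x → meets x (u , v)) R) →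
                         pot M R ≤ pot M′ R′ + 7
  touch-loss-connected connected = touch-loss big
    where
    big : M u ≡ false → M v ≡ false → 4 ≤ total M R u + total M R v + 1
    big Mu Mv with 3 ≤? total M R u + total M R v
    ... | yes 3≤ = +-monoˡ-≤ 1 3≤
    ... | no 3≰ = ⊥-elim (connected Mu Mv closed)
      where
      sum≤2 : deg R u + deg R v ≤ 2
      sum≤2 = ≤-trans (+-mono-≤ (deg≤total M u R) (deg≤total M v R)) (≤-pred (≰⇒> 3≰))
      du : deg R′ u ≡ 0
      du = n≤0⇒n≡0 (+-cancelʳ-≤ 1 _ 0 (≤-trans (+-monoʳ-≤ _ deg-v)
        (≤-pred (subst (λ d → d + deg R v ≤ 2) (deg-meets p u (meetsˡ u v)) sum≤2))))
      dv : deg R′ v ≡ 0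
      dv = n≤0⇒n≡0 (≤-pred (≤-pred (≤-trans (+-mono-≤ deg-u (≤-reflexive (sym (deg-meets p v (meetsʳ u v))))) sum≤2)))
      off : ∀ {f} → f ∈ R′ → ∀ {x} → Incident x f → meets x (u , v) ≡ false
      off f∈ {x} i = ¬meets {e = u , v} {x}
        (λ { refl → ¬does⇒ (incident? u _) (deg≡0⇒¬meets u du f∈) i })
        (λ { refl → ¬does⇒ (incident? v _) (deg≡0⇒¬meets v dv f∈) i })
      closed : Closed (λ x → meets x (u , v)) R
      closed f∈ with ∈-resp-↭ p f∈
      ... | here refl = trans (meetsˡ u v) (sym (meetsʳ u v))
      ... | there f∈′ = trans (off f∈′ (inj₁ refl)) (sym (off f∈′ (inj₂ refl)))

  touch-loss-anchored : Anchored M R → pot M R ≤ pot M′ R′ + 7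
  touch-loss-anchored anchored = touch-loss-connected λ Mu Mv closed →
    contradiction (trans (sym (meetsˡ u v)) (anchored (λ x → meets x (u , v)) (ends Mu Mv) closed uv∈)) λ ()
    where
    ends : M u ≡ false → M v ≡ false → ∀ x → meets x (u , v) ≡ true → M x ≡ false
    ends Mu Mv x m with does⇒ (incident? x (u , v)) m
    ... | inj₁ refl = Mu
    ... | inj₂ refl = Mv

-- Positions in which every unclaimed edge has a marked end

isolated≤value : ∀ k p (R : Vec (Edge n) k) T → ∑ (isolated (touched T) (toList R)) ≤ value k p R T
isolated≤value zero p [] T = ≤-trans (∑-mono (λ v → vertex (touched T v))) (≤-reflexive (sym (score-∑ T)))
  where
  vertex : ∀ b → (if b then 0 else 1) ≤ 𝟙 (not b)
  vertex true = z≤n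
  vertex false = ≤-refl
isolated≤value (suc k) isolator R@(e ∷ _) T with isolator-move R T {e} (here refl)
... | R′ , p , v≤ = ≤-trans
  (∑-mono (λ v → isolated-anti (touched T) {toList R} {toList R′} v (deg-≤ p v)))
  (≤-trans (isolated≤value k toucher R′ T) v≤)
isolated≤value (suc k) toucher R T with toucher-move R T
... | e , R′ , p , v≤ = ≤-trans (∑-mono vertex) (≤-trans (isolated≤value k isolator R′ (e ∷ T)) v≤)
  where
  vertex : ∀ v → isolated (touched T) (toList R) v ≤ isolated (mark e (touched T)) (toList R′) v
  vertex v with meets v e in m
  ... | true = ≤-reflexive (deg>0⇒isolated≡0 (touched T) {toList R} v (meets⇒deg>0 v (∈-resp-↭ (↭-sym p) (here refl)) m))
  ... | false = isolated-anti (touched T) {toList R} {toList R′} v (deg-≤ p v)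

module _ {M : Marking n} where

  open ≤-Reasoning

  -- An edge has 3 units to give: 2 to its unmarked end and 1 to its bonus, or all 3 to its bonus
  -- when both ends are marked.
  load-edge : ∀ e → M (proj₁ e) ∨ M (proj₂ e) ≡ true →
              ∑ (λ v → unmarked M v * load M v e) + bonus M e ≤ 3
  load-edge e@(x , y) Mxy = begin
    ∑ (λ v → unmarked M v * load M v e) + bonus M e
      ≤⟨ +-monoˡ-≤ (bonus M e) (∑-mono vertex) ⟩
    ∑ (λ v → (0 + 2 * unmarked M x * δ x v) + 2 * unmarked M y * δ y v) + bonus M e
      ≡⟨ cong (_+ bonus M e) (trans (∑-+δ (λ v → 0 + 2 * unmarked M x * δ x v) _ y)
          (cong (_+ 2 * unmarked M y) (trans (∑-+δ {n} (λ _ → 0) _ x) (cong (_+ 2 * unmarked M x) (sum-replicate-zero n))))) ⟩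
    2 * unmarked M x + 2 * unmarked M y + bonus M e
      ≤⟨ cost (M x) (M y) Mxy ⟩
    3 ∎
    where
    cost : ∀ a b → a ∨ b ≡ true → 2 * 𝟙 (not a) + 2 * 𝟙 (not b) + bonus′ a b ≤ 3
    cost true  true  _ = ≤-refl
    cost true  false _ = ≤-refl
    cost false true  _ = ≤-refl
    lemma : ∀ a → a * 2 ≡ 2 * a * 1
    lemma = solve-∀
    vertex : ∀ v → unmarked M v * load M v e ≤ (0 + 2 * unmarked M x * δ x v) + 2 * unmarked M y * δ y v
    vertex v with v ≟ x | v ≟ y
    ... | no _ | no _ = ≤-trans (≤-reflexive (*-zeroʳ (unmarked M v))) z≤n
    ... | yes refl | _ rewrite Mxy = ≤-trans (≤-reflexive (lemma (unmarked M v))) (m≤m+n _ _)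
    ... | no _ | yes refl rewrite Mxy = ≤-trans (≤-reflexive (lemma (unmarked M v))) (m≤n+m _ (2 * unmarked M x * 0))

  load-edges : ∀ R → (∀ {e} → e ∈ R → M (proj₁ e) ∨ M (proj₂ e) ≡ true) →
               ∑ (λ v → unmarked M v * total M R v) + ∑ₗ (bonus M) R ≤ 3 * length R
  load-edges [] _ = ≤-reflexive (trans (+-identityʳ _) (trans (sum-cong-≗ (λ v → *-zeroʳ (unmarked M v))) (sum-replicate-zero n)))
  load-edges (e ∷ R) marked = begin
    ∑ (λ v → unmarked M v * (load M v e + total M R v)) + (bonus M e + ∑ₗ (bonus M) R)
      ≡⟨ cong (_+ (bonus M e + ∑ₗ (bonus M) R)) (trans (sum-cong-≗ (λ v → *-distribˡ-+ (unmarked M v) _ _))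
          (∑-distrib-+ (λ v → unmarked M v * load M v e) (λ v → unmarked M v * total M R v))) ⟩
    (∑ (λ v → unmarked M v * load M v e) + ∑ (λ v → unmarked M v * total M R v)) + (bonus M e + ∑ₗ (bonus M) R)
      ≡⟨ lemma₁ (∑ (λ v → unmarked M v * load M v e)) (∑ (λ v → unmarked M v * total M R v))
          (bonus M e) (∑ₗ (bonus M) R) ⟩
    (∑ (λ v → unmarked M v * load M v e) + bonus M e) + (∑ (λ v → unmarked M v * total M R v) + ∑ₗ (bonus M) R)
      ≤⟨ +-mono-≤ (load-edge e (marked (here refl))) (load-edges R (marked ∘ there)) ⟩
    3 + 3 * length R
      ≡⟨ sym (*-suc 3 (length R)) ⟩
    3 * length (e ∷ R) ∎
    where
    lemma₁ : ∀ a b c d → (a + b) + (c + d) ≡ (a + c) + (b + d)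
    lemma₁ = solve-∀

  -- A discharging argument: an isolated vertex is paid its 5 directly, while any other unmarked
  -- vertex has at least two edges of load 2 and so receives its weight 4 from them.
  pot-marked : ∀ R → NoLeaf M R → (∀ {e} → e ∈ R → M (proj₁ e) ∨ M (proj₂ e) ≡ true) →
               pot M R ≤ 5 * ∑ (isolated M R) + 3 * length R
  pot-marked R noLeaf marked = begin
    ∑ (potᵥ M R) + ∑ₗ (bonus M) R
      ≤⟨ +-monoˡ-≤ _ (∑-mono vertex) ⟩
    ∑ (λ v → 5 * isolated M R v + unmarked M v * total M R v) + ∑ₗ (bonus M) R
      ≡⟨ cong (_+ ∑ₗ (bonus M) R) (trans (∑-distrib-+ (λ v → 5 * isolated M R v) (λ v → unmarked M v * total M R v))
          (cong (_+ ∑ (λ v → unmarked M v * total M R v)) (∑-*ˡ 5 (isolated M R)))) ⟩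
    (5 * ∑ (isolated M R) + ∑ (λ v → unmarked M v * total M R v)) + ∑ₗ (bonus M) R
      ≡⟨ +-assoc (5 * ∑ (isolated M R)) _ _ ⟩
    5 * ∑ (isolated M R) + (∑ (λ v → unmarked M v * total M R v) + ∑ₗ (bonus M) R)
      ≤⟨ +-monoʳ-≤ (5 * ∑ (isolated M R)) (load-edges R marked) ⟩
    5 * ∑ (isolated M R) + 3 * length R ∎
    where
    2deg≤total : ∀ v → 2 * deg R v ≤ total M R v
    2deg≤total v = ≤-trans (≤-reflexive (double (deg R v)))
        (≤-trans (≤-reflexive (sym (∑ₗ-+ (𝟙 ∘ meets v) (𝟙 ∘ meets v) R))) (∑ₗ-mono R edge))
      where
      double : ∀ a → 2 * a ≡ a + a
      double = solve-∀
      edge : ∀ {e} → e ∈ R → 𝟙 (meets v e) + 𝟙 (meets v e) ≤ load M v e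
      edge {e} e∈ with meets v e in m
      ... | false = z≤n
      ... | true rewrite marked e∈ = ≤-refl
    vertex : ∀ v → potᵥ M R v ≤ 5 * isolated M R v + unmarked M v * total M R v
    vertex v with M v in Mv
    ... | true = z≤n
    ... | false with deg R v in d
    ... | zero = m≤m+n 5 _
    ... | suc _ = ≤-trans (*-monoʳ-≤ 2 (noLeaf v Mv (subst (0 <_) (sym d) (s≤s z≤n))))
        (≤-trans (2deg≤total v) (≤-reflexive (sym (*-identityˡ _))))

-- Isolator's strategy

IsolatorBound : ℕ → ℕ → Set
IsolatorBound n k = ∀ (R : Vec (Edge n) k) (T : List (Edge n)) → Forest (toList R) → Anchored (touched T) (toList R) →
  pot (touched T) (toList R) ≤ 5 * value k isolator R T + 3 * k

-- Each unclaimed edge budgets 3 units, so a claim costing at most 3 + `s` overdraws by at most `s`.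
-- The uses are `s` = 3 for cost 6 and `s` = 4 for cost 7.
toucher-turn : ∀ s → (∀ {j} → j < k → IsolatorBound n j) → (R : Vec (Edge n) k) (T : List (Edge n)) → Forest (toList R) →
  (∀ {e R′} → toList R ↭ e ∷ R′ →
     Anchored (mark e (touched T)) R′ × pot (touched T) (toList R) ≤ pot (mark e (touched T)) R′ + (3 + s)) →
  pot (touched T) (toList R) ≤ 5 * value k toucher R T + 3 * k + s
toucher-turn s below [] T forest move =
  ≤-trans (≤-reflexive (pot-[] T)) (≤-trans (m≤m+n _ 0) (m≤m+n _ s))
toucher-turn {k = suc k} s below R T forest move with toucher-move R T
... | e , R′ , p , v≤ with move p
... | anchored , loss = begin
    pot (touched T) (toList R) ≤⟨ loss ⟩
    pot (touched (e ∷ T)) (toList R′) + (3 + s)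
      ≤⟨ +-monoˡ-≤ (3 + s) (below ≤-refl R′ (e ∷ T) (Forest-∷ p forest) anchored) ⟩
    5 * value k isolator R′ (e ∷ T) + 3 * k + (3 + s)
      ≤⟨ +-monoˡ-≤ (3 + s) (+-monoˡ-≤ (3 * k) (*-monoʳ-≤ 5 v≤)) ⟩
    5 * value (suc k) toucher R T + 3 * k + (3 + s)
      ≡⟨ lemma (5 * value (suc k) toucher R T) k s ⟩
    5 * value (suc k) toucher R T + 3 * suc k + s ∎
    where
    open ≤-Reasoning
    lemma : ∀ a b c → a + 3 * b + (3 + c) ≡ a + 3 * suc b + c
    lemma = solve-∀

-- The 3 units budgeted for Isolator's own edge are passed on to Toucher's reply.
isolator-turn : ∀ {m} {R : Vec (Edge n) k} {T e} → e ∈ toList R →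
  (∀ {j} (R′ : Vec (Edge n) j) → j < k → toList R ↭ e ∷ toList R′ → m ≤ 5 * value j toucher R′ T + 3 * j + 3) →
  m ≤ 5 * value k isolator R T + 3 * k
isolator-turn {k = suc k} {m} {R} {T} e∈ reply with isolator-move R T e∈
... | R′ , p , v≤ = begin
    m ≤⟨ reply R′ ≤-refl p ⟩
    5 * value k toucher R′ T + 3 * k + 3
      ≤⟨ +-monoˡ-≤ 3 (+-monoˡ-≤ (3 * k) (*-monoʳ-≤ 5 v≤)) ⟩
    5 * value (suc k) isolator R T + 3 * k + 3
      ≡⟨ lemma (5 * value (suc k) isolator R T) k ⟩
    5 * value (suc k) isolator R T + 3 * suc k ∎
    where
    open ≤-Reasoning
    lemma : ∀ a b → a + 3 * b + 3 ≡ a + 3 * suc b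
    lemma = solve-∀
isolator-turn {k = zero} {R = []} ()

calm-turn : (∀ {j} → j < k → IsolatorBound n j) → (R : Vec (Edge n) k) (T : List (Edge n)) → Forest (toList R) →
  Anchored (touched T) (toList R) → Calm (touched T) (toList R) →
  pot (touched T) (toList R) ≤ 5 * value k toucher R T + 3 * k + 3
calm-turn below R T forest anchored calm =
  toucher-turn 3 below R T forest (λ q → touch-anchored q anchored , touch-loss-calm (proj₁ forest) q calm)

bonus≤1 : ∀ {M : Marking n} {a w} {e} → Joins e a w → M a ≡ false → bonus M e ≤ 1
bonus≤1 {M = M} {w = w} (inj₁ refl) Ma rewrite Ma with M w
... | false = z≤n
... | true = ≤-refl
bonus≤1 {M = M} {w = w} (inj₂ refl) Ma rewrite Ma with M w
... | false = z≤n
... | true = ≤-refl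

bonus≡0 : ∀ {M : Marking n} e → M (proj₁ e) ∨ M (proj₂ e) ≡ false → bonus M e ≡ 0
bonus≡0 {M = M} (x , y) eq rewrite ∨-falseˡ (M x) eq | ∨-falseʳ (M x) eq = refl

Joins-unmarked : ∀ {M : Marking n} {a w} {e} → Joins e a w → M (proj₁ e) ∨ M (proj₂ e) ≡ false → M w ≡ false
Joins-unmarked {M = M} {a} {w} (inj₁ refl) eq = ∨-falseʳ (M a) eq
Joins-unmarked {M = M} {a} {w} (inj₂ refl) eq = ∨-falseˡ (M w) eq

unmarked-Joins : ∀ {M : Marking n} {a w} {e} → Joins e a w → M a ≡ false → M w ≡ false → M (proj₁ e) ∨ M (proj₂ e) ≡ false
unmarked-Joins (inj₁ refl) Ma Mw rewrite Ma = Mw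
unmarked-Joins (inj₂ refl) Ma Mw rewrite Mw = Ma

Joins-away : ∀ {a w v : Fin n} {e} → Joins e a w → v ≢ a → v ≢ w → meets v e ≡ false
Joins-away (inj₁ refl) v≢a v≢w = ¬meets v≢a v≢w
Joins-away (inj₂ refl) v≢a v≢w = ¬meets v≢w v≢a

total≡1⇒deg≡1 : ∀ (M : Marking n) R v → total M R v ≡ 1 → deg R v ≡ 1
total≡1⇒deg≡1 M R v t with deg R v in d
... | zero = contradiction (trans (sym t) (deg≡0⇒total≡0 M v {R} d)) λ ()
... | suc zero = refl
... | suc (suc _) = contradiction (subst (_≤ 1) d (≤-trans (deg≤total M v R) (≤-reflexive t))) λ { (s≤s ()) }

module _ {M : Marking n} {R : List (Edge n)} (noLeaf : NoLeaf M R) where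

  -- The degree of `a` is at least 2, so a total of 2 forces load exactly 1 on every edge at `a`,
  -- and load 1 means unmarked ends.
  unmarked-neighbour : ∀ {a w e} → total M R a ≡ 2 → M a ≡ false → e ∈ R → Joins e a w →
                       M w ≡ false
  unmarked-neighbour {a} {w} {e} t Ma e∈ j = Joins-unmarked {M = M} j (load≤1⇒unmarked M a e m
      (≤-trans (∑ₗ-tight R (λ {f} _ → meets≤load M a f) (≤-trans (≤-reflexive t) (noLeaf a Ma (meets⇒deg>0 a e∈ m))) e∈)
               (≤-reflexive (cong 𝟙 m))))
    where
    m : meets a e ≡ true
    m = Joins⇒meets j

  noLeaf⇒calm : Calm M R
  noLeaf⇒calm v Mv d = ≤-trans (noLeaf v Mv d) (deg≤total M v R)

  -- Otherwise the vertices of total 2 form a union of components without marked vertices.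
  all-large : Anchored M R →
    (∀ {a w e} → e ∈ R → Joins e a w → M a ≡ false → total M R a ≡ 2 → M w ≡ false → ¬ 3 ≤ total M R w) →
    ∀ v → M v ≡ false → 0 < deg R v → 3 ≤ total M R v
  all-large anchored none v Mv d with deg>0⇒∃ {R = R} v d
  ... | e , e∈ , m = ≤∧≢⇒< (noLeaf⇒calm v Mv d) (λ t → contradiction (trans (sym (in-S Mv (sym t))) off) λ ())
    where
    S : Fin _ → Bool
    S x = not (M x) ∧ does (total M R x ℕ.≟ 2)
    in-S : ∀ {x} → M x ≡ false → total M R x ≡ 2 → S x ≡ true
    in-S {x} Mx t rewrite Mx = dec-true (total M R x ℕ.≟ 2) t
    S⇒M : ∀ x → S x ≡ true → M x ≡ false
    S⇒M x s with M x
    ... | false = refl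
    S⇒total : ∀ x → S x ≡ true → total M R x ≡ 2
    S⇒total x s with M x
    ... | false = does⇒ (total M R x ℕ.≟ 2) s
    step : ∀ {x y e} → e ∈ R → Joins e x y → S x ≡ true → S y ≡ true
    step {x} {y} e∈ j s = in-S My (≤-antisym (≤-pred (≰⇒> (none e∈ j Mx t My)))
        (noLeaf⇒calm y My (meets⇒deg>0 y e∈ (Joins⇒meets (Sum.swap j)))))
      where
      Mx = S⇒M x s
      t = S⇒total x s
      My = unmarked-neighbour t Mx e∈ j
    closed : Closed S R
    closed {x , y} e∈ with S x in sx | S y in sy
    ... | true | true = refl
    ... | false | false = refl
    ... | true | false = trans (sym (step e∈ (inj₁ refl) sx)) sy
    ... | false | true = trans (sym sx) (step e∈ (inj₂ refl) sy)
    off : S v ≡ false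
    off with does⇒ (incident? v e) m
    ... | inj₁ refl = anchored S S⇒M closed e∈
    ... | inj₂ refl = trans (sym (closed e∈)) (anchored S S⇒M closed e∈)

-- The threat at a vertex of degree two

module _ {M : Marking n} {R R₁ : List (Edge n)} {a b w : Fin n} {f g : Edge n}
  (forest : Forest R) (noLeaf : NoLeaf M R)
  (g∈ : g ∈ R) (jg : Joins g a w) (f∈ : f ∈ R) (jf : Joins f a b) (b≢w : b ≢ w)
  (Ma : M a ≡ false) (ta : total M R a ≡ 2) (Mw : M w ≡ false) (tw : 3 ≤ total M R w)
  (p₁ : R ↭ f ∷ R₁) where

  private
    simple : IsSimple R
    simple = proj₁ forest
    w≢a : w ≢ a
    w≢a = Adj⇒≢ simple (Joins⇒Adj g∈ jg) ∘ sym
    total₁ : ∀ {y} → y ≢ a → y ≢ b → total M R y ≡ total M R₁ y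
    total₁ {y} y≢a y≢b = total-away M y p₁ (Joins-away jf y≢a y≢b)
    deg₁a : deg R₁ a ≡ 1
    deg₁a = suc-injective (trans (sym (deg-meets p₁ a (Joins⇒meets jf)))
      (≤-antisym (≤-trans (deg≤total M a R) (≤-reflexive ta)) (noLeaf a Ma (meets⇒deg>0 a g∈ (Joins⇒meets jg)))))

  leaf-edge-kept : g ∈ R₁
  leaf-edge-kept with ∈-resp-↭ p₁ g∈
  ... | there g∈₁ = g∈₁
  ... | here refl with trans (sym (Joins⇒meets (Sum.swap jg))) (Joins-away jf w≢a (b≢w ∘ sym))
  ... | ()

  -- Toucher can only lose more than 6 here by touching b, leaving the leaf a to Isolator.
  module _ {e : Edge n} {R₂ : List (Edge n)} (p₂ : R₁ ↭ e ∷ R₂)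
    (bad : ¬ pot M R₁ ≤ pot (mark e M) R₂ + 6) where

    private
      e∈₁ : e ∈ R₁
      e∈₁ = ∈-resp-↭ (↭-sym p₂) (here refl)
      e∈ : e ∈ R
      e∈ = ∈-resp-↭ (↭-sym p₁) (there e∈₁)
      simple₁ : IsSimple R₁
      simple₁ = proj₁ (Forest-∷ p₁ forest)
      e-unmarked : M (proj₁ e) ∨ M (proj₂ e) ≡ false
      e-unmarked with M (proj₁ e) ∨ M (proj₂ e) in eq
      ... | false = refl
      ... | true = contradiction (touch-marked p₂ eq) bad
      small : total M R₁ (proj₁ e) + total M R₁ (proj₂ e) ≤ 3
      small with 4 ≤? total M R₁ (proj₁ e) + total M R₁ (proj₂ e)
      ... | no 4≰ = ≤-pred (≰⇒> 4≰)
      ... | yes 4≤ = contradiction (touch-loss simple₁ p₂ (λ _ _ → ≤-trans 4≤ (m≤m+n _ 0))) bad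
      small′ : ∀ {x y} → Joins e x y → total M R₁ x + total M R₁ y ≤ 3
      small′ (inj₁ refl) = small
      small′ {x} {y} (inj₂ refl) = subst (_≤ 3) (+-comm (total M R₁ y) _) small
      -- The total of `w` is still at least 3 and the other end of `e` would add at least 1,
      -- exceeding `small`.
      w∉e : meets w e ≡ false
      w∉e with meets w e in m
      ... | false = refl
      ... | true with z , j ← meets⇒Joins w m =
        contradiction (≤-trans (+-mono-≤ (subst (3 ≤_) (total₁ w≢a (b≢w ∘ sym)) tw)
            (≤-trans (meets⇒deg>0 z e∈₁ (Joins⇒meets (Sum.swap j))) (deg≤total M z R₁))) (small′ j))
          λ { (s≤s (s≤s (s≤s ()))) }
      a∉e : meets a e ≡ false
      a∉e with meets a e in m
      ... | false = refl
      ... | true with refl ← deg≡1⇒unique-edge a deg₁a leaf-edge-kept e∈₁ (Joins⇒meets jg) m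
        with () ← trans (sym (Joins⇒meets (Sum.swap jg))) w∉e
      -- Otherwise `e` avoids both ends of `f`, so its own ends keep totals of at least 2 each,
      -- exceeding `small`.
      b∈e : meets b e ≡ true
      b∈e with meets b e in m
      ... | true = refl
      ... | false = contradiction (≤-trans (+-mono-≤
            (large (¬meets⇒≢₁ {e = e} a∉e) (¬meets⇒≢₁ {e = e} m) (∨-falseˡ _ e-unmarked)
              (meets⇒deg>0 (proj₁ e) e∈ (meetsˡ (proj₁ e) (proj₂ e))))
            (large (¬meets⇒≢₂ {e = e} a∉e) (¬meets⇒≢₂ {e = e} m) (∨-falseʳ (M (proj₁ e)) e-unmarked)
              (meets⇒deg>0 (proj₂ e) e∈ (meetsʳ (proj₁ e) (proj₂ e))))) small)
          λ { (s≤s (s≤s (s≤s ()))) }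
        where
        large : ∀ {y} → y ≢ a → y ≢ b → M y ≡ false → 0 < deg R y → 2 ≤ total M R₁ y
        large y≢a y≢b My d = subst (2 ≤_) (total₁ y≢a y≢b) (noLeaf⇒calm {R = R} noLeaf _ My d)

    leaf-edge-survives : g ∈ R₂
    leaf-edge-survives with ∈-resp-↭ p₂ leaf-edge-kept
    ... | there g∈₂ = g∈₂
    ... | here refl with trans (sym (Joins⇒meets (Sum.swap jg))) w∉e
    ... | ()

    leaf-unmarked : mark e M a ≡ false
    leaf-unmarked rewrite a∉e = Ma

    support-unmarked : mark e M w ≡ false
    support-unmarked rewrite w∉e = Mw

    leaf-deg : deg R₂ a ≡ 1
    leaf-deg = trans (sym (trans (deg-∷ p₂ a) (cong (λ x → 𝟙 x + deg R₂ a) a∉e))) deg₁a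

    -- `b` is marked and `a` is isolated by now. Among the other unmarked vertices only `w` loses
    -- load, namely 1 out of at least 3, and marking the ends of `e` can only raise loads.
    leaf-calm : ∀ {R₃} → R₂ ↭ g ∷ R₃ → Calm (mark e M) R₃
    leaf-calm {R₃} p₃ y M′y d =
      ≤-trans rest (∑ₗ-mono R₃ (λ {h} _ → load-mark M y e h))
      where
      y∉e : meets y e ≡ false
      y∉e = ∨-falseˡ (meets y e) M′y
      y≢b : y ≢ b
      y≢b refl with () ← trans (sym b∈e) y∉e
      y≢a : y ≢ a
      y≢a refl = contradiction (subst (0 <_) (suc-injective (trans (sym (deg-meets p₃ a (Joins⇒meets jg))) leaf-deg)) d) λ ()
      total₂ : total M R y ≡ load M y g + total M R₃ y
      total₂ = trans (total₁ y≢a y≢b) (trans (total-away M y p₂ y∉e) (total-∷ M y p₃))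
      rest : 2 ≤ total M R₃ y
      rest with y ≟ w
      ... | yes refl = ≤-pred (≤-trans (≤-trans tw (≤-reflexive total₂))
              (+-monoˡ-≤ _ (load-unmarked M y g (∨-falseˡ _ g-unmarked) (∨-falseʳ (M (proj₁ g)) g-unmarked))))
        where
        g-unmarked : M (proj₁ g) ∨ M (proj₂ g) ≡ false
        g-unmarked = unmarked-Joins {M = M} jg Ma Mw
      ... | no y≢w = subst (2 ≤_) (trans total₂ (cong (_+ total M R₃ y) (load-away M y g (Joins-away jg y≢a y≢w))))
              (noLeaf⇒calm {R = R} noLeaf y (∨-falseʳ (meets y e) M′y)
                (≤-trans d (≤-trans (deg-≤ p₃ y) (≤-trans (deg-≤ p₂ y) (deg-≤ p₁ y)))))

-- The leaf edge carries no bonus, so isolating `a` gains 1. The reply in a calm position costs at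
-- most 6, which leaves this 1 as a surplus.
take-leaf : (∀ {j} → j < k → IsolatorBound n j) → (R : Vec (Edge n) k) (T : List (Edge n)) → Forest (toList R) →
  Anchored (touched T) (toList R) → ∀ {a w g} → g ∈ toList R → Joins g a w → touched T a ≡ false → touched T w ≡ false →
  deg (toList R) a ≡ 1 → (∀ {R′} → toList R ↭ g ∷ R′ → Calm (touched T) R′) →
  suc (pot (touched T) (toList R)) ≤ 5 * value k isolator R T + 3 * k
take-leaf below R T forest anchored {a} {w} {g} g∈ jg Ma Mw d calm = isolator-turn {R = R} g∈ λ R′ j<k p →
  ≤-trans (isolate-leaf p Ma d (Joins⇒meets jg))
    (≤-trans (≤-reflexive (trans (cong (pot (touched T) (toList R′) +_)
        (bonus≡0 {M = touched T} g (unmarked-Joins {M = touched T} jg Ma Mw))) (+-identityʳ _)))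
      (calm-turn (λ i<j → below (<-trans i<j j<k)) R′ T (Forest-∷ p forest)
        (leaf-anchored p (ends-≢ (proj₁ forest) g∈) Ma d (Joins⇒meets jg) anchored) (calm p)))

-- Claiming `ab` is free because `b` is unmarked too. A reply costing at most 6 is within the
-- budget; a reply costing 7 is repaid by the surplus of `take-leaf` at `a`.
double-threat : (∀ {j} → j < k → IsolatorBound n j) → (R : Vec (Edge n) k) (T : List (Edge n)) →
  Forest (toList R) → Anchored (touched T) (toList R) → NoLeaf (touched T) (toList R) →
  ∀ {a w g} → g ∈ toList R → Joins g a w →
  touched T a ≡ false → total (touched T) (toList R) a ≡ 2 →
  touched T w ≡ false → 3 ≤ total (touched T) (toList R) w →
  pot (touched T) (toList R) ≤ 5 * value k isolator R T + 3 * k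
double-threat {k = k} {n} below R T forest anchored noLeaf {a} {w} {g} g∈ jg Ma ta Mw tw
  with second-neighbour (proj₁ forest) (Joins⇒Adj g∈ jg) (noLeaf a Ma (meets⇒deg>0 a g∈ (Joins⇒meets jg)))
... | b , b≢w , adj with Adj⇒Joins adj
... | f , f∈ , jf = isolator-turn {R = R} f∈ λ R₁ j<k p₁ → ≤-trans (gain p₁) (reply R₁ j<k p₁)
  where
  open ≤-Reasoning
  M : Marking n
  M = touched T
  gain : ∀ {R₁} → toList R ↭ f ∷ R₁ → pot M (toList R) ≤ pot M R₁
  gain {R₁} p₁ = ≤-trans (isolate p₁) (≤-reflexive (trans (cong (pot M R₁ +_)
    (bonus≡0 {M = M} f (unmarked-Joins {M = M} jf Ma (unmarked-neighbour noLeaf ta Ma f∈ jf)))) (+-identityʳ _)))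
  lemma : ∀ a b → a + 3 * b + 6 ≡ a + 3 * suc b + 3
  lemma = solve-∀
  reply : ∀ {j} (R₁ : Vec (Edge n) j) → j < k → toList R ↭ f ∷ toList R₁ →
          pot M (toList R₁) ≤ 5 * value j toucher R₁ T + 3 * j + 3
  reply [] _ _ = ≤-trans (≤-reflexive (pot-[] T)) (≤-trans (m≤m+n _ 0) (m≤m+n _ 3))
  reply {suc j} R₁@(_ ∷ _) j<k p₁ with toucher-move R₁ T
  ... | e , R₂ , p₂ , v₂≤ = begin
    pot M (toList R₁) ≤⟨ loss ⟩
    5 * value j isolator R₂ (e ∷ T) + 3 * j + 6 ≤⟨ +-monoˡ-≤ 6 (+-monoˡ-≤ (3 * j) (*-monoʳ-≤ 5 v₂≤)) ⟩
    5 * value (suc j) toucher R₁ T + 3 * j + 6 ≡⟨ lemma (5 * value (suc j) toucher R₁ T) j ⟩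
    5 * value (suc j) toucher R₁ T + 3 * suc j + 3 ∎
    where
    forest₁ : Forest (toList R₁)
    forest₁ = Forest-∷ p₁ forest
    anchored₁ : Anchored M (toList R₁)
    anchored₁ = cut-anchored p₁ forest noLeaf anchored
    loss : pot M (toList R₁) ≤ 5 * value j isolator R₂ (e ∷ T) + 3 * j + 6
    loss with pot M (toList R₁) ≤? pot (mark e M) (toList R₂) + 6
    ... | yes good = ≤-trans good
      (+-monoˡ-≤ 6 (below (<-trans (n<1+n j) j<k) R₂ (e ∷ T) (Forest-∷ p₂ forest₁) (touch-anchored p₂ anchored₁)))
    ... | no bad = begin
      pot M (toList R₁) ≤⟨ touch-loss-anchored (proj₁ forest₁) p₂ anchored₁ ⟩
      pot (mark e M) (toList R₂) + 7 ≡⟨ +-suc (pot (mark e M) (toList R₂)) 6 ⟩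
      suc (pot (mark e M) (toList R₂)) + 6
        ≤⟨ +-monoˡ-≤ 6 (take-leaf (λ i<j → below (<-trans i<j (<-trans (n<1+n j) j<k))) R₂ (e ∷ T)
             (Forest-∷ p₂ forest₁) (touch-anchored p₂ anchored₁)
             (leaf-edge-survives forest noLeaf g∈ jg f∈ jf b≢w Ma ta Mw tw p₁ p₂ bad) jg
             (leaf-unmarked forest noLeaf g∈ jg f∈ jf b≢w Ma ta Mw tw p₁ p₂ bad)
             (support-unmarked forest noLeaf g∈ jg f∈ jf b≢w Ma ta Mw tw p₁ p₂ bad)
             (leaf-deg forest noLeaf g∈ jg f∈ jf b≢w Ma ta Mw tw p₁ p₂ bad)
             (leaf-calm forest noLeaf g∈ jg f∈ jf b≢w Ma ta Mw tw p₁ p₂ bad)) ⟩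
      5 * value j isolator R₂ (e ∷ T) + 3 * j + 6 ∎

¬∃leaf⇒NoLeaf : ∀ {M : Marking n} {R} → ¬ (∃[ v ] M v ≡ false × deg R v ≡ 1) → NoLeaf M R
¬∃leaf⇒NoLeaf none v Mv d = ≤∧≢⇒< d (λ d≡1 → none (v , Mv , sym d≡1))

isolator-bound-step : ∀ k → (∀ {j} → j < k → IsolatorBound n j) → IsolatorBound n k
isolator-bound-step {n} k below R T forest anchored
  with Fin.any? (λ a → (touched T a ≟ᵇ false) ×-dec (total (touched T) (toList R) a ℕ.≟ 1))
... | yes (a , Ma , ta) with deg>0⇒∃ {R = toList R} a (≤-reflexive (sym (total≡1⇒deg≡1 (touched T) (toList R) a ta)))
-- The gain of 1 pays for a reply that costs 7, hence the slack 4.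
... | e , e∈ , m = isolator-turn {R = R} e∈ λ R′ j<k p → ≤-pred (≤-trans (gain p) (≤-trans
    (toucher-turn 4 (λ i<j → below (<-trans i<j j<k)) R′ T (Forest-∷ p forest)
      (λ q → touch-anchored q (anchored′ p) , touch-loss-anchored (proj₁ (Forest-∷ p forest)) q (anchored′ p)))
    (≤-reflexive (+-suc _ 3))))
  where
  M : Marking n
  M = touched T
  d : deg (toList R) a ≡ 1
  d = total≡1⇒deg≡1 M (toList R) a ta
  anchored′ : ∀ {R′} → toList R ↭ e ∷ R′ → Anchored M R′
  anchored′ p = leaf-anchored p (ends-≢ (proj₁ forest) e∈) Ma d m anchored
  gain : ∀ {R′} → toList R ↭ e ∷ R′ → suc (pot M (toList R)) ≤ pot M R′
  gain {R′} p = ≤-trans (isolate-leaf p Ma d m) (≤-reflexive (trans (cong (pot M R′ +_)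
    (bonus≡0 {M = M} e (load≤1⇒unmarked M a e m (≤-trans (∈⇒≤∑ₗ (load M a) e∈) (≤-reflexive ta))))) (+-identityʳ _)))
isolator-bound-step {n} k below R T forest anchored | no no-total-1
  with Fin.any? (λ a → (touched T a ≟ᵇ false) ×-dec (deg (toList R) a ℕ.≟ 1))
... | yes (a , Ma , d) with deg>0⇒∃ {R = toList R} a (≤-reflexive (sym d))
... | e , e∈ , m with meets⇒Joins a m
... | w , j = isolator-turn {R = R} e∈ λ R′ j<k p → ≤-trans (gain p)
    (calm-turn (λ i<j → below (<-trans i<j j<k)) R′ T (Forest-∷ p forest)
      (leaf-anchored p (ends-≢ (proj₁ forest) e∈) Ma d m anchored) (calm p))
  where
  M : Marking n
  M = touched T
  -- The bonus lost is at most 1 and is balanced by the newly isolated leaf.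
  gain : ∀ {R′} → toList R ↭ e ∷ R′ → pot M (toList R) ≤ pot M R′
  gain {R′} p = ≤-pred (≤-trans (isolate-leaf p Ma d m)
    (≤-trans (+-monoʳ-≤ (pot M R′) (bonus≤1 {M = M} j Ma)) (≤-reflexive (+-comm _ 1))))
  -- No unmarked vertex has total 1, and totals change only at the ends of `e`. There `a` has no
  -- edge left, and `w` is marked, for otherwise `a` would have had total 1.
  calm : ∀ {R′} → toList R ↭ e ∷ R′ → Calm M R′
  calm {R′} p v Mv 0<d = subst (2 ≤_) (total-away M v p (Joins-away j v≢a v≢w))
      (≤∧≢⇒< (≤-trans (≤-trans 0<d (deg-≤ p v)) (deg≤total M v (toList R))) (λ t → no-total-1 (v , Mv , sym t)))
    where
    d′ : deg R′ a ≡ 0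
    d′ = suc-injective (trans (sym (deg-meets p a m)) d)
    v≢a : v ≢ a
    v≢a refl = contradiction (subst (0 <_) d′ 0<d) λ ()
    v≢w : v ≢ w
    v≢w refl = no-total-1 (a , Ma , ≤-antisym
      (≤-trans (≤-reflexive (trans (total-∷ M a p)
          (trans (cong (load M a e +_) (deg≡0⇒total≡0 M a {R′} d′)) (+-identityʳ _))))
        (load-unmarked M a e (∨-falseˡ _ e-unmarked) (∨-falseʳ (M (proj₁ e)) e-unmarked)))
      (≤-trans (≤-reflexive (sym d)) (deg≤total M a (toList R))))
      where
      e-unmarked : M (proj₁ e) ∨ M (proj₂ e) ≡ false
      e-unmarked = unmarked-Joins {M = M} j Ma Mv
isolator-bound-step {n} k below R T forest anchored | no no-total-1 | no no-leaf
  -- Without unmarked leaves, total 2 at `a` means degree 2 with unmarked neighbours, and total at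
  -- least 3 at the neighbour `w` means a marked neighbour or degree at least 3. Edges are stored in
  -- one orientation, so both are tested.
  with any? (λ e → P? (proj₁ e) (proj₂ e) ⊎-dec P? (proj₂ e) (proj₁ e)) (toList R)
  where
  P? : ∀ a w → Dec (touched T a ≡ false × total (touched T) (toList R) a ≡ 2 ×
                    touched T w ≡ false × 3 ≤ total (touched T) (toList R) w)
  P? a w = (touched T a ≟ᵇ false) ×-dec (total (touched T) (toList R) a ℕ.≟ 2) ×-dec
           (touched T w ≟ᵇ false) ×-dec (3 ≤? total (touched T) (toList R) w)
... | yes found with find found
... | e , e∈ , inj₁ (Ma , ta , Mw , tw) =
  double-threat below R T forest anchored (¬∃leaf⇒NoLeaf {R = toList R} no-leaf) e∈ (inj₁ refl) Ma ta Mw tw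
... | e , e∈ , inj₂ (Ma , ta , Mw , tw) =
  double-threat below R T forest anchored (¬∃leaf⇒NoLeaf {R = toList R} no-leaf) e∈ (inj₂ refl) Ma ta Mw tw
isolator-bound-step {n} k below R T forest anchored | no no-total-1 | no no-leaf | no none
  with any? (λ e → touched T (proj₁ e) ∨ touched T (proj₂ e) ≟ᵇ false) (toList R)
... | no all-marked = ≤-trans
    (pot-marked (toList R) (¬∃leaf⇒NoLeaf {R = toList R} no-leaf) (λ {e} e∈ → ¬-not (λ eq → all-marked (lose e∈ eq))))
    (+-mono-≤ (*-monoʳ-≤ 5 (isolated≤value k isolator R T)) (≤-reflexive (cong (3 *_) (length-toList R))))
... | yes found with find found
... | e , e∈ , e-unmarked = isolator-turn {R = R} e∈ λ R′ j<k p → ≤-trans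
    (≤-trans (isolate p) (≤-reflexive (trans (cong (pot M (toList R′) +_)
      (bonus≡0 {M = M} e e-unmarked)) (+-identityʳ _))))
    (calm-turn (λ i<j → below (<-trans i<j j<k)) R′ T (Forest-∷ p forest) (cut-anchored p forest noLeaf anchored) (calm p))
  where
  M : Marking n
  M = touched T
  noLeaf : NoLeaf M (toList R)
  noLeaf = ¬∃leaf⇒NoLeaf {R = toList R} no-leaf
  large : ∀ v → M v ≡ false → 0 < deg (toList R) v → 3 ≤ total M (toList R) v
  large = all-large noLeaf anchored λ where
    e∈ (inj₁ refl) Ma ta Mw tw → none (lose e∈ (inj₁ (Ma , ta , Mw , tw)))
    e∈ (inj₂ refl) Ma ta Mw tw → none (lose e∈ (inj₂ (Ma , ta , Mw , tw)))
  -- Totals were at least 3 by `all-large`, and an edge with unmarked ends takes away at most 1.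
  calm : ∀ {R′} → toList R ↭ e ∷ R′ → Calm M R′
  calm {R′} p v Mv 0<d = ≤-pred (≤-trans (≤-trans (large v Mv (≤-trans 0<d (deg-≤ p v))) (≤-reflexive (total-∷ M v p)))
    (+-monoˡ-≤ (total M R′ v) (load-unmarked M v e (∨-falseˡ _ e-unmarked) (∨-falseʳ (M (proj₁ e)) e-unmarked))))

isolator-bound : ∀ k → IsolatorBound n k
isolator-bound = <-rec (IsolatorBound _) isolator-bound-step

-- Trees

nonisolated : List (Edge n) → Fin n → ℕ
nonisolated R v = 𝟙 (not (isZero (deg R v)))

nonisolated-mono : ∀ {R R′ : List (Edge n)} {e} → R ↭ e ∷ R′ → ∀ v → nonisolated R′ v ≤ nonisolated R v
nonisolated-mono p v = mono (deg-≤ p v)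
  where
  mono : ∀ {c d} → c ≤ d → 𝟙 (not (isZero c)) ≤ 𝟙 (not (isZero d))
  mono z≤n = z≤n
  mono (s≤s _) = ≤-refl

-- Induction by removing the edge of a leaf, which isolates that leaf. The leaf is sought away from
-- `x`, since only the start of a walk is excused from having a second neighbour; without such a
-- leaf the walk from `x` would close a cycle.
forest-size : ∀ k (R : List (Edge n)) → length R ≡ suc k → Forest R → suc (suc k) ≤ ∑ (nonisolated R)
forest-size {n} zero R@((x , y) ∷ []) _ forest = begin
  2 ≡⟨ cong (λ z → z + 1 + 1) (sym (sum-replicate-zero n)) ⟩
  ∑ {n} (λ _ → 0) + 1 + 1 ≡⟨ cong (_+ 1) (sym (∑-+δ {n} (λ _ → 0) 1 x)) ⟩
  ∑ (λ v → 0 + 1 * δ x v) + 1 ≡⟨ sym (∑-+δ (λ v → 0 + 1 * δ x v) 1 y) ⟩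
  ∑ (λ v → (0 + 1 * δ x v) + 1 * δ y v) ≤⟨ ∑-mono vertex ⟩
  ∑ (nonisolated R) ∎
  where
  open ≤-Reasoning
  x≢y : x ≢ y
  x≢y = ends-≢ (proj₁ forest) {x , y} (here refl)
  vertex : ∀ v → (0 + 1 * δ x v) + 1 * δ y v ≤ nonisolated R v
  vertex v with v ≟ x | v ≟ y
  ... | yes refl | yes refl = contradiction refl x≢y
  ... | yes refl | no _ = ≤-refl
  ... | no _ | yes refl = ≤-refl
  ... | no _ | no _ = z≤n
forest-size {n} (suc k) R@((x , y) ∷ _) len forest with Fin.any? (λ v → ¬? (v ≟ x) ×-dec (deg R v ℕ.≟ 1))
... | no none = contradiction
  (closed-walk (proj₁ forest) (λ _ → ⊤) (λ _ _ → tt) x next (inj₁ (here refl)) tt) (proj₂ forest)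
  where
  next : ∀ {v p} → v ≢ x → ⊤ → Adj R v p → ∃[ q ] q ≢ p × Adj R v q
  next {v} v≢x _ adj with Adj⇒Joins adj
  ... | f , f∈ , j = second-neighbour (proj₁ forest) adj
    (≤∧≢⇒< (meets⇒deg>0 v f∈ (Joins⇒meets j)) (λ d → none (v , v≢x , sym d)))
... | yes (a , _ , d) with deg>0⇒∃ {R = R} a (≤-reflexive (sym d))
... | f , f∈ , m with ∈⇒↭ f∈
... | R′ , p = begin
  suc (suc (suc k)) ≤⟨ s≤s (forest-size k R′ (suc-injective (trans (sym (↭-length p)) len)) (Forest-∷ p forest)) ⟩
  suc (∑ (nonisolated R′)) ≡⟨ +-comm 1 _ ⟩
  ∑ (nonisolated R′) + 1 ≡⟨ sym (∑-+δ (nonisolated R′) 1 a) ⟩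
  ∑ (λ v → nonisolated R′ v + 1 * δ a v) ≤⟨ ∑-mono vertex ⟩
  ∑ (nonisolated R) ∎
  where
  open ≤-Reasoning
  d′ : deg R′ a ≡ 0
  d′ = suc-injective (trans (sym (deg-meets p a m)) d)
  vertex : ∀ v → nonisolated R′ v + 1 * δ a v ≤ nonisolated R v
  vertex v with v ≟ a
  ... | yes refl rewrite d | d′ = ≤-refl
  ... | no _ = ≤-trans (≤-reflexive (+-identityʳ _)) (nonisolated-mono p v)

forest-edges<n : 0 < n → (E : List (Edge n)) → Forest E → length E < n
forest-edges<n 0<n [] _ = 0<n
forest-edges<n {n} _ E@(_ ∷ E′) forest = ≤-trans (forest-size (length E′) E refl forest)
  (≤-trans (∑-mono (λ v → bound (not (isZero (deg E v))))) (≤-reflexive (trans (∑-const n 1) (*-identityʳ n))))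
  where
  bound : ∀ b → 𝟙 b ≤ 1
  bound true = ≤-refl
  bound false = z≤n

closed-constant : ∀ {E : List (Edge n)} {S u v} → Closed S E → Star (Adj E) u v → S u ≡ S v
closed-constant closed ε = refl
closed-constant closed (inj₁ e∈ ◅ path) = trans (closed e∈) (closed-constant closed path)
closed-constant closed (inj₂ e∈ ◅ path) = trans (sym (closed e∈)) (closed-constant closed path)

not-all-met : 3 ≤ n → (e : Edge n) → ¬ (∀ z → meets z e ≡ true)
not-all-met {n} 3≤n (u , v) met = <⇒≱ 3≤n (begin
  n ≡⟨ sym (trans (∑-const n 1) (*-identityʳ n)) ⟩
  ∑ {n} (λ _ → 1) ≤⟨ ∑-mono vertex ⟩
  ∑ (λ z → (0 + 1 * δ u z) + 1 * δ v z) ≡⟨ ∑-+δ (λ z → 0 + 1 * δ u z) 1 v ⟩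
  ∑ (λ z → 0 + 1 * δ u z) + 1 ≡⟨ cong (_+ 1) (∑-+δ {n} (λ _ → 0) 1 u) ⟩
  ∑ {n} (λ _ → 0) + 1 + 1 ≡⟨ cong (λ z → z + 1 + 1) (sum-replicate-zero n) ⟩
  2 ∎)
  where
  open ≤-Reasoning
  vertex : ∀ z → 1 ≤ (0 + 1 * δ u z) + 1 * δ v z
  vertex z with z ≟ u | z ≟ v | met z
  ... | yes _ | _ | _ = s≤s z≤n
  ... | no _ | yes _ | _ = ≤-refl

-- Nothing is marked before the first move, so connectedness stands in for `Anchored` there; that
-- move may cost 7, hence the slack 4.
tree-bound : 3 ≤ n → (R : Vec (Edge n) k) → IsTree (toList R) → n ≤ 5 * value k toucher R [] + 1
tree-bound {n} {k} 3≤n R (simple , connected , acyclic) = +-cancelʳ-≤ (3 * n) _ _ (begin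
  n + 3 * n ≡⟨ lemma₁ n ⟩
  n * 4 ≡⟨ sym (∑-const n 4) ⟩
  ∑ {n} (λ _ → 4) ≤⟨ ∑-mono (λ v → m≤m+n 4 (isolated M (toList R) v)) ⟩
  ∑ (potᵥ M (toList R)) ≤⟨ m≤m+n _ _ ⟩
  pot M (toList R) ≤⟨ toucher-turn 4 (λ {j} _ → isolator-bound j) R [] forest first ⟩
  5 * value k toucher R [] + 3 * k + 4 ≡⟨ lemma₂ (5 * value k toucher R []) k ⟩
  5 * value k toucher R [] + 1 + 3 * suc k ≤⟨ +-monoʳ-≤ (5 * value k toucher R [] + 1) (*-monoʳ-≤ 3 k<n) ⟩
  5 * value k toucher R [] + 1 + 3 * n ∎)
  where
  open ≤-Reasoning
  M : Marking n
  M = touched []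
  forest : Forest (toList R)
  forest = simple , acyclic
  k<n : k < n
  k<n = subst (_< n) (length-toList R) (forest-edges<n (≤-trans (s≤s z≤n) 3≤n) (toList R) forest)
  lemma₁ : ∀ a → a + 3 * a ≡ a * 4
  lemma₁ = solve-∀
  lemma₂ : ∀ a b → a + 3 * b + 4 ≡ a + 1 + 3 * suc b
  lemma₂ = solve-∀
  first : ∀ {e R′} → toList R ↭ e ∷ R′ → Anchored (mark e M) R′ × pot M (toList R) ≤ pot (mark e M) R′ + 7
  -- If `uv` were a whole component, connectedness would make it contain all of the at least three
  -- vertices.
  first {e} {R′} p = anchored , touch-loss-connected simple p (λ _ _ closed →
      not-all-met 3≤n e (λ z → trans (sym (closed-constant {S = λ x → meets x e} closed (connected (proj₁ e) z)))
        (meetsˡ (proj₁ e) (proj₂ e))))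
    where
    anchored : Anchored (mark e M) R′
    -- Closedness extends to the whole tree, so `S` is constant, and it is false at the marked end
    -- of `e`.
    anchored S off-M cl {f} f∈ with S (proj₁ f) in eq
    ... | false = refl
    ... | true = trans (sym (mark-first M e)) (off-M (proj₁ e)
      (trans (closed-constant {S = S} (touch-closed {M = M} p S off-M cl) (connected (proj₁ e) (proj₁ f))) eq))

theorem1p1 : (n : ℕ) (E : List (Edge n)) → IsTree E → 3 ≤ n → (n + 3) / 5 ≤ u E
-- From n ≤ 5 u + 1 follows n + 3 < 5 (u + 1), so the quotient is below u + 1.
theorem1p1 n E tree 3≤n = ≤-pred (m<n*o⇒m/o<n (begin-strict
  n + 3 ≤⟨ +-monoˡ-≤ 3 (tree-bound 3≤n (fromList E) (subst IsTree (sym (toList∘fromList E)) tree)) ⟩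
  5 * u E + 1 + 3 <⟨ n<1+n _ ⟩
  suc (5 * u E + 1 + 3) ≡⟨ lemma (u E) ⟩
  suc (u E) * 5 ∎))
  where
  open ≤-Reasoning
  lemma : ∀ a → suc (5 * a + 1 + 3) ≡ suc a * 5
  lemma = solve-∀
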